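{- There is an arithmetical sentence that is extremely independent from $\mathsf{PA}$.
   Context: $\mathsf{PA}$ is Peano Arithmetic. $x:F$ denotes the standard arithmetical proof predicate of $\mathsf{PA}$ ("$x$ is a code of a proof in $\mathsf{PA}$ of $F$"), and $\Box F$ denotes the standard provability predicate $\exists x\,(x:F)$. $\Box^n$ is the $n$-fold iteration of $\Box$. An arithmetical sentence is constructively true if it is provable in $\mathsf{PA}$. For $n\geq 1$, put $cf^n(F)=\forall x\,\Box^n\neg(x:F)$ (inside $\Box$ the variable $x$ stands for its numeral); an arithmetical sentence $A$ is $n$-constructively false if $\mathsf{PA}$ proves $cf^n(A)$. An arithmetical sentence $A$ is strongly independent from $\mathsf{PA}$ if it is neither constructively true nor $n$-constructively false for any $n\geq 1$. $A$ is extremely independent from $\mathsf{PA}$ if both $A$ and $\neg A$ are strongly independent from $\mathsf{PA}$. -}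

module Defs where

open import Data.Nat using (ℕ; zero; suc; _∸_; _<_; _≥_)
import Data.Nat as ℕ
open import Data.List using (List; []; _∷_; foldr; map)
open import Data.List.Membership.Propositional using (_∈_)
open import Data.Product using (_×_; ∃-syntax)
open import Data.Unit using (⊤)
open import Function using (id)
open import Relation.Nullary using (¬_)

infix  31 _[_] _[_]ᵗ _at_
infix  30 S_
infixl 29 _⊗_
infixl 28 _⊕_
infix  26 _≐_
infix  25 ~_
infixr 22 _⇒_

-- The first-order language {0, S, +, ·, =}.  Variables are de Bruijn indices:
-- `all A` binds index 0 of A.

data Term : Set where
  var     : ℕ → Term
  𝟎       : Term
  S_      : Term → Term
  _⊕_ _⊗_ : Term → Term → Term

data Formula : Set where
  _≐_ : Term → Term → Formula
  ⊥̇   : Formula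
  _⇒_ : Formula → Formula → Formula
  all : Formula → Formula

~_ : Formula → Formula
~ A = A ⇒ ⊥̇

numeral : ℕ → Term
numeral zero    = 𝟎
numeral (suc n) = S numeral n

VarsBelowᵗ : ℕ → Term → Set
VarsBelowᵗ n (var i) = i < n
VarsBelowᵗ n 𝟎       = ⊤
VarsBelowᵗ n (S t)   = VarsBelowᵗ n t
VarsBelowᵗ n (t ⊕ u) = VarsBelowᵗ n t × VarsBelowᵗ n u
VarsBelowᵗ n (t ⊗ u) = VarsBelowᵗ n t × VarsBelowᵗ n u

VarsBelow : ℕ → Formula → Set
VarsBelow n (t ≐ u) = VarsBelowᵗ n t × VarsBelowᵗ n u
VarsBelow n ⊥̇       = ⊤
VarsBelow n (A ⇒ B) = VarsBelow n A × VarsBelow n B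
VarsBelow n (all A) = VarsBelow (suc n) A

IsSentence : Formula → Set
IsSentence = VarsBelow 0

-- Finitely presented simultaneous substitutions, which can therefore be
-- Gödel numbered:
--   shift   : xᵢ ↦ xᵢ₊₁
--   inst t  : x₀ ↦ t, xᵢ₊₁ ↦ xᵢ
--   step    : x₀ ↦ S x₀, other variables fixed
--   lift σ  : σ pushed under a quantifier

data Subst : Set where
  shift : Subst
  inst  : Term → Subst
  step  : Subst
  lift  : Subst → Subst

substVars : (ℕ → Term) → Term → Term
substVars f (var i) = f i
substVars f 𝟎       = 𝟎
substVars f (S t)   = S substVars f t
substVars f (t ⊕ u) = substVars f t ⊕ substVars f u
substVars f (t ⊗ u) = substVars f t ⊗ substVars f u

_at_ : Subst → ℕ → Term
shift  at i       = var (suc i)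
inst t at zero    = t
inst t at (suc i) = var i
step   at zero    = S var 0
step   at (suc i) = var (suc i)
lift σ at zero    = var 0
lift σ at (suc i) = substVars (λ j → var (suc j)) (σ at i)

_[_]ᵗ : Term → Subst → Term
t [ σ ]ᵗ = substVars (σ at_) t

_[_] : Formula → Subst → Formula
(t ≐ u) [ σ ] = (t [ σ ]ᵗ) ≐ (u [ σ ]ᵗ)
⊥̇       [ σ ] = ⊥̇
(A ⇒ B) [ σ ] = (A [ σ ]) ⇒ (B [ σ ])
(all A) [ σ ] = all (A [ lift σ ])

-- Open axioms amount to their universal closures, by generalization.

basicAxioms : List Formula
basicAxioms =
    x ≐ x
  ∷ x ≐ y ⇒ x ≐ z ⇒ y ≐ z
  ∷ x ≐ y ⇒ S x ≐ S y
  ∷ x ≐ y ⇒ z ≐ w ⇒ x ⊕ z ≐ y ⊕ w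
  ∷ x ≐ y ⇒ z ≐ w ⇒ x ⊗ z ≐ y ⊗ w
  ∷ ~ (S x ≐ 𝟎)
  ∷ S x ≐ S y ⇒ x ≐ y
  ∷ x ⊕ 𝟎 ≐ x
  ∷ x ⊕ S y ≐ S (x ⊕ y)
  ∷ x ⊗ 𝟎 ≐ 𝟎
  ∷ x ⊗ S y ≐ x ⊗ y ⊕ x
  ∷ []
  where
  x = var 0
  y = var 1
  z = var 2
  w = var 3

infix 10 PA⊢_

data PA⊢_ : Formula → Set where
  basic     : ∀ {A} → A ∈ basicAxioms → PA⊢ A
  ax-K      : ∀ {A B} → PA⊢ A ⇒ B ⇒ A
  ax-S      : ∀ {A B C} → PA⊢ (A ⇒ B ⇒ C) ⇒ (A ⇒ B) ⇒ A ⇒ C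
  ax-DN     : ∀ {A} → PA⊢ ~ ~ A ⇒ A
  ax-inst   : ∀ {A} t → PA⊢ all A ⇒ A [ inst t ]
  ax-dist   : ∀ {A B} → PA⊢ all (A ⇒ B) ⇒ all A ⇒ all B
  ax-vac    : ∀ {A} → PA⊢ A ⇒ all (A [ shift ])
  induction : ∀ {A} → PA⊢ A [ inst 𝟎 ] ⇒ all (A ⇒ A [ step ]) ⇒ all A
  mp        : ∀ {A B} → PA⊢ A → PA⊢ A ⇒ B → PA⊢ B
  gen       : ∀ {A} → PA⊢ A → PA⊢ all A

-- The code constructors are used both on ℕ, for Gödel numbers, and on
-- arithmetical terms, for the formulas that speak about Gödel numbers.

module Coding {C : Set} (lit : ℕ → C) (pair : C → C → C) where

  cvar cS call : C → C
  cplus ctimes ceq cimp : C → C → C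
  czero cbot : C
  cvar i     = pair (lit 0) i
  czero      = pair (lit 1) (lit 0)
  cS a       = pair (lit 2) a
  cplus a b  = pair (lit 3) (pair a b)
  ctimes a b = pair (lit 4) (pair a b)
  ceq a b    = pair (lit 5) (pair a b)
  cbot       = pair (lit 6) (lit 0)
  cimp a b   = pair (lit 7) (pair a b)
  call a     = pair (lit 8) a

  cshift cstep : C
  cinst clift : C → C
  cshift  = pair (lit 0) (lit 0)
  cinst t = pair (lit 1) t
  cstep   = pair (lit 2) (lit 0)
  clift σ = pair (lit 3) σ

  codeᵗ : Term → C
  codeᵗ (var i) = cvar (lit i)
  codeᵗ 𝟎       = czero
  codeᵗ (S t)   = cS (codeᵗ t)
  codeᵗ (t ⊕ u) = cplus (codeᵗ t) (codeᵗ u)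
  codeᵗ (t ⊗ u) = ctimes (codeᵗ t) (codeᵗ u)

  code : Formula → C
  code (t ≐ u) = ceq (codeᵗ t) (codeᵗ u)
  code ⊥̇       = cbot
  code (A ⇒ B) = cimp (code A) (code B)
  code (all A) = call (code A)

-- ⟪ m , n ⟫ = (m + n)² + m is injective because m ≤ m + n.  It is opaque only
-- to keep Agda from evaluating astronomically large Gödel numbers, and so is
-- the same polynomial ⟨_,_⟩ below.

opaque
  ⟪_,_⟫ : ℕ → ℕ → ℕ
  ⟪ m , n ⟫ = (m ℕ.+ n) ℕ.* (m ℕ.+ n) ℕ.+ m

⌜_⌝ : Formula → ℕ
⌜_⌝ = Coding.code id ⟪_,_⟫

-- Terms and formulas with named variables: an expression is a function of the
-- number d of quantifiers enclosing it, and the variable bound by the (l+1)-st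
-- of them is index d - l - 1.

Tm Fm : Set
Tm = ℕ → Term
Fm = ℕ → Formula

bound : ℕ → Tm
bound l d = var (d ∸ suc l)

-- A(x₀), with free variable x₀
formula₁ : (Tm → Fm) → Formula
formula₁ A = A (bound 0) 1

infixl 28 _+̇_
infixl 29 _*̇_
infix  25 ¬̇_
infix  26 _=̇_ _≤̇_ _<̇_
infixr 24 _∧̇_
infixr 23 _∨̇_
infixr 22 _⇒̇_
infix  20 ∀̇ ∃̇

num : ℕ → Tm
num n _ = numeral n

suċ : Tm → Tm
suċ s d = S s d

_+̇_ _*̇_ : Tm → Tm → Tm
(s +̇ t) d = s d ⊕ t d
(s *̇ t) d = s d ⊗ t d

_=̇_ : Tm → Tm → Fm
(s =̇ t) d = s d ≐ t d

¬̇_ : Fm → Fm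
(¬̇ A) d = ~ A d

_⇒̇_ _∧̇_ _∨̇_ : Fm → Fm → Fm
(A ⇒̇ B) d = A d ⇒ B d
A ∧̇ B = ¬̇ (A ⇒̇ ¬̇ B)
A ∨̇ B = ¬̇ A ⇒̇ B

∀̇ ∃̇ : (Tm → Fm) → Fm
∀̇ A d = all (A (bound d) (suc d))
∃̇ A = ¬̇ ∀̇ λ x → ¬̇ A x

syntax ∀̇ (λ x → A) = ∀̇[ x ] A
syntax ∃̇ (λ x → A) = ∃̇[ x ] A

⋁ : List Fm → Fm
⋁ = foldr _∨̇_ (λ _ → ⊥̇)

_≤̇_ _<̇_ : Tm → Tm → Fm
s ≤̇ t = ∃̇[ k ] k +̇ s =̇ t
s <̇ t = suċ s ≤̇ t

opaque
  ⟨_,_⟩ : Tm → Tm → Tm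
  ⟨ s , t ⟩ = (s +̇ t) *̇ (s +̇ t) +̇ s

open Coding num ⟨_,_⟩ hiding (codeᵗ; code)

-- Gödel's β-function: s = ⟨ a , b ⟩ has i-th entry y = a mod (1 + (i + 1) b).

Entry : Tm → Tm → Tm → Fm
Entry s i y =
  ∃̇[ a ] ∃̇[ b ] ∃̇[ q ]
    s =̇ ⟨ a , b ⟩ ∧̇ a =̇ q *̇ suċ (suċ i *̇ b) +̇ y ∧̇ y <̇ suċ (suċ i *̇ b)

-- A rule says when y follows from earlier entries; `earlier` is the predicate
-- of being an earlier entry.

Rule : Set
Rule = (earlier : Tm → Fm) → Tm → Fm

-- The entries s₀, …, sₙ are each obtained by the rule, and sₙ = y.
Derivation : Rule → Tm → Tm → Tm → Fm
Derivation R s n y =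
  Entry s n y ∧̇
  (∀̇[ i ] i ≤̇ n ⇒̇
    (∃̇[ z ] Entry s i z ∧̇ R (λ w → ∃̇[ j ] j <̇ i ∧̇ Entry s j w) z))

Generated : Rule → Tm → Fm
Generated R y = ∃̇[ s ] ∃̇[ n ] Derivation R s n y

-- Well-formedness: term t and formula A are represented by ⟨ 0 , t ⟩ and
-- ⟨ 1 , A ⟩.

term form : Tm → Tm
term t = ⟨ num 0 , t ⟩
form a = ⟨ num 1 , a ⟩

formationRule : Rule
formationRule earlier y = ⋁
  ( (∃̇[ i ] y =̇ term (cvar i))
  ∷ (y =̇ term czero)
  ∷ (∃̇[ t ] earlier (term t) ∧̇ y =̇ term (cS t))
  ∷ (∃̇[ t ] ∃̇[ u ] earlier (term t) ∧̇ earlier (term u) ∧̇ y =̇ term (cplus t u))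
  ∷ (∃̇[ t ] ∃̇[ u ] earlier (term t) ∧̇ earlier (term u) ∧̇ y =̇ term (ctimes t u))
  ∷ (∃̇[ t ] ∃̇[ u ] earlier (term t) ∧̇ earlier (term u) ∧̇ y =̇ form (ceq t u))
  ∷ (y =̇ form cbot)
  ∷ (∃̇[ a ] ∃̇[ b ] earlier (form a) ∧̇ earlier (form b) ∧̇ y =̇ form (cimp a b))
  ∷ (∃̇[ a ] earlier (form a) ∧̇ y =̇ form (call a))
  ∷ [])

IsTerm IsFormula : Tm → Fm
IsTerm t    = Generated formationRule (term t)
IsFormula a = Generated formationRule (form a)

-- sub σ a b represents a [ σ ] = b, for terms and for formulas.

sub : Tm → Tm → Tm → Tm
sub σ a b = ⟨ σ , ⟨ a , b ⟩ ⟩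

binary : (Tm → Tm → Tm) → Rule
binary op earlier y =
  ∃̇[ σ ] ∃̇[ a ] ∃̇[ b ] ∃̇[ a′ ] ∃̇[ b′ ]
    earlier (sub σ a a′) ∧̇ earlier (sub σ b b′) ∧̇
    y =̇ sub σ (op a b) (op a′ b′)

substRule : Rule
substRule earlier y = ⋁
  ( (∃̇[ i ] y =̇ sub cshift (cvar i) (cvar (suċ i)))
  ∷ (∃̇[ t ] y =̇ sub (cinst t) (cvar (num 0)) t)
  ∷ (∃̇[ t ] ∃̇[ i ] y =̇ sub (cinst t) (cvar (suċ i)) (cvar i))
  ∷ (y =̇ sub cstep (cvar (num 0)) (cS (cvar (num 0))))
  ∷ (∃̇[ i ] y =̇ sub cstep (cvar (suċ i)) (cvar (suċ i)))
  ∷ (∃̇[ σ ] y =̇ sub (clift σ) (cvar (num 0)) (cvar (num 0)))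
  ∷ (∃̇[ σ ] ∃̇[ i ] ∃̇[ t ] ∃̇[ u ]
       earlier (sub σ (cvar i) t) ∧̇ earlier (sub cshift t u) ∧̇
       y =̇ sub (clift σ) (cvar (suċ i)) u)
  ∷ (∃̇[ σ ] y =̇ sub σ czero czero)
  ∷ (∃̇[ σ ] ∃̇[ t ] ∃̇[ u ] earlier (sub σ t u) ∧̇ y =̇ sub σ (cS t) (cS u))
  ∷ binary cplus earlier y
  ∷ binary ctimes earlier y
  ∷ binary ceq earlier y
  ∷ (∃̇[ σ ] y =̇ sub σ cbot cbot)
  ∷ binary cimp earlier y
  ∷ (∃̇[ σ ] ∃̇[ a ] ∃̇[ b ]
       earlier (sub (clift σ) a b) ∧̇ y =̇ sub σ (call a) (call b))
  ∷ [])

SubstitutesTo : Tm → Tm → Tm → Fm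
SubstitutesTo σ a b = Generated substRule (sub σ a b)

-- ⟨ n , u ⟩: u is the code of the numeral of n.

numeralRule : Rule
numeralRule earlier y = ⋁
  ( (y =̇ ⟨ num 0 , czero ⟩)
  ∷ (∃̇[ n ] ∃̇[ u ] earlier ⟨ n , u ⟩ ∧̇ y =̇ ⟨ suċ n , cS u ⟩)
  ∷ [])

NumeralCode : Tm → Tm → Fm
NumeralCode n u = Generated numeralRule ⟨ n , u ⟩

-- One clause for each constructor of PA⊢_.

proofRule : Rule
proofRule earlier y = ⋁
  ( ⋁ (map (λ A → y =̇ num ⌜ A ⌝) basicAxioms)
  ∷ (∃̇[ a ] ∃̇[ b ] IsFormula a ∧̇ IsFormula b ∧̇ y =̇ cimp a (cimp b a))
  ∷ (∃̇[ a ] ∃̇[ b ] ∃̇[ c ] IsFormula a ∧̇ IsFormula b ∧̇ IsFormula c ∧̇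
       y =̇ cimp (cimp a (cimp b c)) (cimp (cimp a b) (cimp a c)))
  ∷ (∃̇[ a ] IsFormula a ∧̇ y =̇ cimp (cimp (cimp a cbot) cbot) a)
  ∷ (∃̇[ a ] ∃̇[ t ] ∃̇[ b ] IsFormula a ∧̇ IsTerm t ∧̇
       SubstitutesTo (cinst t) a b ∧̇ y =̇ cimp (call a) b)
  ∷ (∃̇[ a ] ∃̇[ b ] IsFormula a ∧̇ IsFormula b ∧̇
       y =̇ cimp (call (cimp a b)) (cimp (call a) (call b)))
  ∷ (∃̇[ a ] ∃̇[ b ] IsFormula a ∧̇
       SubstitutesTo cshift a b ∧̇ y =̇ cimp a (call b))
  ∷ (∃̇[ a ] ∃̇[ b ] ∃̇[ c ] IsFormula a ∧̇
       SubstitutesTo (cinst czero) a b ∧̇ SubstitutesTo cstep a c ∧̇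
       y =̇ cimp b (cimp (call (cimp a c)) (call a)))
  ∷ (∃̇[ a ] earlier a ∧̇ earlier (cimp a y))
  ∷ (∃̇[ a ] earlier a ∧̇ y =̇ call a)
  ∷ [])

-- x codes a finite sequence of formulas that is a proof of y.
Proof : Tm → Tm → Fm
Proof x y = ∃̇[ s ] ∃̇[ n ] x =̇ ⟨ s , n ⟩ ∧̇ Derivation proofRule s n y

Provable : Tm → Fm
Provable y = ∃̇[ x ] Proof x y

-- "x₀ is a proof of F"
x:_ : Formula → Formula
x: F = formula₁ λ x → Proof x (num ⌜ F ⌝)

-- □ G, where the variable x₀ of G is replaced by its numeral inside □; so x₀
-- is again the variable of □ G.
□_ : Formula → Formula
□ G = formula₁ λ x →
  ∃̇[ u ] ∃̇[ z ] NumeralCode x u ∧̇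
    SubstitutesTo (cinst u) (num ⌜ G ⌝) z ∧̇ Provable z

□^ : ℕ → Formula → Formula
□^ zero    G = G
□^ (suc n) G = □ (□^ n G)

cf : ℕ → Formula → Formula
cf n F = all (□^ n (~ (x: F)))

ConstructivelyTrue : Formula → Set
ConstructivelyTrue A = PA⊢ A

ConstructivelyFalse : ℕ → Formula → Set
ConstructivelyFalse n A = PA⊢ cf n A

StronglyIndependent : Formula → Set
StronglyIndependent A =
  ¬ ConstructivelyTrue A × ¬ (∃[ n ] n ≥ 1 × ConstructivelyFalse n A)

ExtremelyIndependent : Formula → Set
ExtremelyIndependent A = StronglyIndependent A × StronglyIndependent (~ A)

{-# OPTIONS --safe #-}

-- A Rosser argument.  PA is sound for the standard model, so PA ⊢ cf n F implies PA ⊬ F: the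
-- instances of cf n F truly say that no number is a proof of F.  Call F refuted if PA proves ~ F or
-- some cf n F; then F is unprovable.  This is a Σ₁ condition on ⌜ F ⌝, and diagonalization yields a
-- sentence A saying "A is refuted by a witness below which ~ A is not refuted" (where ~ A is refuted
-- if PA proves A or some cf n (~ A)).  Were A refuted first, A would be a true Σ₁ sentence, hence
-- provable; were ~ A refuted first, ~ A would be provable.  Both are absurd, so neither is refuted,
-- which is extreme independence.  Witnesses are compared by bounding all existential
-- quantifiers of a Σ₁ formula, after which PA decides its instances.

module Submission where

open import Defs
  using (Term; var; 𝟎; S_; _⊕_; _⊗_; Formula; _≐_; ⊥̇; _⇒_; all; ~_; numeral; VarsBelowᵗ;
         VarsBelow; IsSentence; Subst; shift; inst; step; lift; substVars; _at_; _[_]ᵗ; _[_];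
         basicAxioms; PA⊢_; basic; ax-K; ax-S; ax-DN; ax-inst; ax-dist; ax-vac; induction;
         mp; gen; ⟪_,_⟫; ⌜_⌝; bound; ⟨_,_⟩; x:_; □_; □^; cf; ExtremelyIndependent)
open import Data.Bool using (T; not)
open import Data.Empty using (⊥; ⊥-elim)
open import Data.List using (List; []; _++_; _∷_; foldr; length; map)
open import Data.List.Membership.Propositional using (_∈_)
open import Data.List.Membership.Propositional.Properties using (∈-++⁺ʳ; ∈-++⁺ˡ)
open import Data.List.Relation.Unary.Any using (here; there)
open import Data.Nat
  using (_!; _*_; _+_; _<_; _<ᵇ_; _∸_; _≡ᵇ_; _≤_; _⊔_; suc; s≤s; zero; z≤n; ℕ)
open import Data.Nat.Coprimality using (Coprime; coprime-Bézout; coprime-divisor)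
open import Data.Nat.DivMod using ([m+kn]%n≡m%n; _%_; _/_; m<n⇒m%n≡m; m≡m%n+[m/n]*n)
open import Data.Nat.Divisibility
  using (_∣_; divides; m∣m*n; m≤n⇒m!∣n!; ∣-refl; ∣-trans; ∣1⇒≡1; ∣m+n∣m⇒∣n; ∣m⇒∣m*n; ∣n⇒∣m*n)
open import Data.Nat.GCD using (module Bézout)
open import Data.Nat.Induction using (<-rec)
open import Data.Nat.Properties
  using (*-mono-≤; *-monoʳ-<; *-suc; *-zeroʳ; +-cancelˡ-≡; +-comm; +-identityʳ; +-monoʳ-≤;
         +-suc; +-∸-assoc; <-cmp; <-irrefl; <-trans; <ᵇ⇒<; <⇒≤; _!≢0; _≟_; _≤?_; m<n⇒0<n∸m;
         m<n⇒m<1+n; module ≤-Reasoning; m∸n+n≡m; m∸n≤m; m≤m+n; m≤m⊔n; m≤n*m; m≤n+m;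
         m≤n⇒m<n∨m≡n; m≤n⇒m≤1+n; m≤n⊔m; n<1+n; n∸n≡0; suc-injective; ≤-<-trans; ≤-pred;
         ≤-refl; ≤-trans)
open import Data.Nat.Solver using (module +-*-Solver)
open import Data.Product using (_,_; _×_; map₂; proj₁; proj₂; Σ; ∃-syntax)
open import Data.Sum using ([_,_]′; _⊎_; inj₁; inj₂)
open import Data.Unit using (tt; ⊤)
open import Function using (_∘_; id)
open import Relation.Binary.Definitions using (tri<; tri>; tri≈)
open import Relation.Binary.PropositionalEquality
  using (_≡_; _≢_; refl; sym; trans; cong; cong₂; subst; subst₂; module ≡-Reasoning)
open import Relation.Nullary using (Dec; no; yes; ¬_)
open import Relation.Nullary.Decidable using (T?; _×-dec_; decidable-stable; toWitness)
open import Level using (0ℓ) renaming (suc to lsuc)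

-- An ordinary Gödel or Rosser sentence will not do. PA proves that the provability of such a
-- sentence entails inconsistency, and that a number which is no proof of it is provably none; so PA
-- proves `cf 1` of it. The diagonal sentence must therefore speak of the formulas `cf n`
-- themselves. All n fit into one Σ₁ condition because the codes of `□^ n (~ (x: F))` are generated
-- by repeated substitution into one fixed template of `□`.
--
-- The metatheory is constructive and formulas lack ∨ and ∃, so a true Σ₁ formula yields its
-- witnesses only up to double negation. This is harmless: the witnesses only ever serve to reach a
-- contradiction or a stable statement.

-- Parallel substitution

infixr 5 _∷ᵉ_

_∷ᵉ_ : {X : Set} → X → (ℕ → X) → ℕ → X
(x ∷ᵉ f) zero    = x
(x ∷ᵉ f) (suc i) = f i

substVars-cong : ∀ {f g} → (∀ i → f i ≡ g i) → ∀ t → substVars f t ≡ substVars g t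
substVars-cong e (var i) = e i
substVars-cong e 𝟎       = refl
substVars-cong e (S t)   = cong S_ (substVars-cong e t)
substVars-cong e (t ⊕ u) = cong₂ _⊕_ (substVars-cong e t) (substVars-cong e u)
substVars-cong e (t ⊗ u) = cong₂ _⊗_ (substVars-cong e t) (substVars-cong e u)

substVars-∘ : ∀ f g t → substVars f (substVars g t) ≡ substVars (substVars f ∘ g) t
substVars-∘ f g (var i) = refl
substVars-∘ f g 𝟎       = refl
substVars-∘ f g (S t)   = cong S_ (substVars-∘ f g t)
substVars-∘ f g (t ⊕ u) = cong₂ _⊕_ (substVars-∘ f g t) (substVars-∘ f g u)
substVars-∘ f g (t ⊗ u) = cong₂ _⊗_ (substVars-∘ f g t) (substVars-∘ f g u)

substVars-var : ∀ t → substVars var t ≡ t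
substVars-var (var i) = refl
substVars-var 𝟎       = refl
substVars-var (S t)   = cong S_ (substVars-var t)
substVars-var (t ⊕ u) = cong₂ _⊕_ (substVars-var t) (substVars-var u)
substVars-var (t ⊗ u) = cong₂ _⊗_ (substVars-var t) (substVars-var u)

substVars-numeral : ∀ f n → substVars f (numeral n) ≡ numeral n
substVars-numeral f zero    = refl
substVars-numeral f (suc n) = cong S_ (substVars-numeral f n)

raise : Term → Term
raise = substVars (λ i → var (suc i))

exts : (ℕ → Term) → ℕ → Term
exts f = var 0 ∷ᵉ raise ∘ f

-- `Subst` is not closed under composition, but maps from variables to terms are. Equations between
-- iterated substitutions thus reduce to comparing the images of the variables.
_∙_ : Formula → (ℕ → Term) → Formula
(t ≐ u) ∙ f = substVars f t ≐ substVars f u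
⊥̇       ∙ f = ⊥̇
(A ⇒ B) ∙ f = A ∙ f ⇒ B ∙ f
(all A) ∙ f = all (A ∙ (exts f))

infixl 31 _∙_

exts-cong : ∀ {f g} → (∀ i → f i ≡ g i) → ∀ i → exts f i ≡ exts g i
exts-cong e zero    = refl
exts-cong e (suc i) = cong raise (e i)

∙-cong : ∀ {f g} → (∀ i → f i ≡ g i) → ∀ A → A ∙ f ≡ A ∙ g
∙-cong e (t ≐ u) = cong₂ _≐_ (substVars-cong e t) (substVars-cong e u)
∙-cong e ⊥̇       = refl
∙-cong e (A ⇒ B) = cong₂ _⇒_ (∙-cong e A) (∙-cong e B)
∙-cong e (all A) = cong all (∙-cong (exts-cong e) A)

exts-∘ : ∀ f g i → substVars (exts f) (exts g i) ≡ exts (substVars f ∘ g) i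
exts-∘ f g zero    = refl
exts-∘ f g (suc i) = trans (substVars-∘ (exts f) (λ j → var (suc j)) (g i))
                           (sym (substVars-∘ (λ j → var (suc j)) f (g i)))

∙-∘ : ∀ f g A → A ∙ g ∙ f ≡ A ∙ (substVars f ∘ g)
∙-∘ f g (t ≐ u) = cong₂ _≐_ (substVars-∘ f g t) (substVars-∘ f g u)
∙-∘ f g ⊥̇       = refl
∙-∘ f g (A ⇒ B) = cong₂ _⇒_ (∙-∘ f g A) (∙-∘ f g B)
∙-∘ f g (all A) = cong all (trans (∙-∘ (exts f) (exts g) A) (∙-cong (exts-∘ f g) A))

lift-at : ∀ σ i → lift σ at i ≡ exts (σ at_) i
lift-at σ zero    = refl
lift-at σ (suc i) = refl

[]-∙ : ∀ σ A → A [ σ ] ≡ A ∙ (σ at_)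
[]-∙ σ (t ≐ u) = refl
[]-∙ σ ⊥̇       = refl
[]-∙ σ (A ⇒ B) = cong₂ _⇒_ ([]-∙ σ A) ([]-∙ σ B)
[]-∙ σ (all A) = cong all (trans ([]-∙ (lift σ) A) (∙-cong (lift-at σ) A))

∙-[] : ∀ f σ A → A ∙ f [ σ ] ≡ A ∙ (λ i → f i [ σ ]ᵗ)
∙-[] f σ A = trans ([]-∙ σ (A ∙ f)) (∙-∘ (σ at_) f A)

raise-inst : ∀ t u → raise t [ inst u ]ᵗ ≡ t
raise-inst t u = trans (substVars-∘ _ _ t) (substVars-var t)

exts-inst : ∀ f u i → exts f i [ inst u ]ᵗ ≡ (u ∷ᵉ f) i
exts-inst f u zero    = refl
exts-inst f u (suc i) = raise-inst (f i) u

∙-exts-inst : ∀ f u A → A ∙ (exts f) [ inst u ] ≡ A ∙ (u ∷ᵉ f)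
∙-exts-inst f u A = trans (∙-[] (exts f) (inst u) A) (∙-cong (exts-inst f u) A)

-- The standard model.  Formulas are built without ∨ and ∃, hence are stable,
-- which validates ax-DN constructively.

Env : Set
Env = ℕ → ℕ

eval : Env → Term → ℕ
eval ρ (var i) = ρ i
eval ρ 𝟎       = 0
eval ρ (S t)   = suc (eval ρ t)
eval ρ (t ⊕ u) = eval ρ t + eval ρ u
eval ρ (t ⊗ u) = eval ρ t * eval ρ u

⟦_⟧ : Formula → Env → Set
⟦ t ≐ u ⟧ ρ = eval ρ t ≡ eval ρ u
⟦ ⊥̇ ⟧     ρ = ⊥
⟦ A ⇒ B ⟧ ρ = ⟦ A ⟧ ρ → ⟦ B ⟧ ρ
⟦ all A ⟧ ρ = ∀ n → ⟦ A ⟧ (n ∷ᵉ ρ)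

⟦⟧-stable : ∀ A {ρ} → ¬ ¬ ⟦ A ⟧ ρ → ⟦ A ⟧ ρ
⟦⟧-stable (t ≐ u) h   = decidable-stable (_ ≟ _) h
⟦⟧-stable ⊥̇       h   = h id
⟦⟧-stable (A ⇒ B) h a = ⟦⟧-stable B λ nb → h λ f → nb (f a)
⟦⟧-stable (all A) h n = ⟦⟧-stable A λ na → h λ f → na (f n)

eval-cong : ∀ {ρ ρ′} → (∀ i → ρ i ≡ ρ′ i) → ∀ t → eval ρ t ≡ eval ρ′ t
eval-cong e (var i) = e i
eval-cong e 𝟎       = refl
eval-cong e (S t)   = cong suc (eval-cong e t)
eval-cong e (t ⊕ u) = cong₂ _+_ (eval-cong e t) (eval-cong e u)
eval-cong e (t ⊗ u) = cong₂ _*_ (eval-cong e t) (eval-cong e u)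

∷ᵉ-cong : ∀ {X : Set} {ρ ρ′ : ℕ → X} n → (∀ i → ρ i ≡ ρ′ i) → ∀ i → (n ∷ᵉ ρ) i ≡ (n ∷ᵉ ρ′) i
∷ᵉ-cong n e zero    = refl
∷ᵉ-cong n e (suc i) = e i

⟦⟧-cong : ∀ A {ρ ρ′} → (∀ i → ρ i ≡ ρ′ i) → ⟦ A ⟧ ρ → ⟦ A ⟧ ρ′
⟦⟧-cong (t ≐ u) e h   = trans (sym (eval-cong e t)) (trans h (eval-cong e u))
⟦⟧-cong (A ⇒ B) e h a = ⟦⟧-cong B e (h (⟦⟧-cong A (sym ∘ e) a))
⟦⟧-cong (all A) e h n = ⟦⟧-cong A (∷ᵉ-cong n e) (h n)

eval-substVars : ∀ ρ f t → eval ρ (substVars f t) ≡ eval (eval ρ ∘ f) t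
eval-substVars ρ f (var i) = refl
eval-substVars ρ f 𝟎       = refl
eval-substVars ρ f (S t)   = cong suc (eval-substVars ρ f t)
eval-substVars ρ f (t ⊕ u) = cong₂ _+_ (eval-substVars ρ f t) (eval-substVars ρ f u)
eval-substVars ρ f (t ⊗ u) = cong₂ _*_ (eval-substVars ρ f t) (eval-substVars ρ f u)

eval-numeral : ∀ ρ n → eval ρ (numeral n) ≡ n
eval-numeral ρ zero    = refl
eval-numeral ρ (suc n) = cong suc (eval-numeral ρ n)

eval-exts : ∀ ρ f n i → eval (n ∷ᵉ ρ) (exts f i) ≡ (n ∷ᵉ eval ρ ∘ f) i
eval-exts ρ f n zero    = refl
eval-exts ρ f n (suc i) = eval-substVars (n ∷ᵉ ρ) (λ j → var (suc j)) (f i)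

⟦∙⟧⇒ : ∀ A {ρ f} → ⟦ A ∙ f ⟧ ρ → ⟦ A ⟧ (eval ρ ∘ f)
⟦∙⟧⇐ : ∀ A {ρ f} → ⟦ A ⟧ (eval ρ ∘ f) → ⟦ A ∙ f ⟧ ρ
⟦∙⟧⇒ (t ≐ u) {ρ} {f} h = trans (sym (eval-substVars ρ f t)) (trans h (eval-substVars ρ f u))
⟦∙⟧⇒ (A ⇒ B) h a = ⟦∙⟧⇒ B (h (⟦∙⟧⇐ A a))
⟦∙⟧⇒ (all A) {ρ} {f} h n = ⟦⟧-cong A (eval-exts ρ f n) (⟦∙⟧⇒ A (h n))
⟦∙⟧⇐ (t ≐ u) {ρ} {f} h = trans (eval-substVars ρ f t) (trans h (sym (eval-substVars ρ f u)))
⟦∙⟧⇐ (A ⇒ B) h a = ⟦∙⟧⇐ B (h (⟦∙⟧⇒ A a))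
⟦∙⟧⇐ (all A) {ρ} {f} h n = ⟦∙⟧⇐ A (⟦⟧-cong A (sym ∘ eval-exts ρ f n) (h n))

⟦[]⟧⇒ : ∀ A σ {ρ} → ⟦ A [ σ ] ⟧ ρ → ⟦ A ⟧ (λ i → eval ρ (σ at i))
⟦[]⟧⇒ A σ h = ⟦∙⟧⇒ A (subst (λ B → ⟦ B ⟧ _) ([]-∙ σ A) h)

⟦[]⟧⇐ : ∀ A σ {ρ} → ⟦ A ⟧ (λ i → eval ρ (σ at i)) → ⟦ A [ σ ] ⟧ ρ
⟦[]⟧⇐ A σ h = subst (λ B → ⟦ B ⟧ _) (sym ([]-∙ σ A)) (⟦∙⟧⇐ A h)

eval-inst : ∀ ρ t i → eval ρ (inst t at i) ≡ (eval ρ t ∷ᵉ ρ) i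
eval-inst ρ t zero    = refl
eval-inst ρ t (suc i) = refl

eval-step : ∀ ρ n i → eval (n ∷ᵉ ρ) (step at i) ≡ (suc n ∷ᵉ ρ) i
eval-step ρ n zero    = refl
eval-step ρ n (suc i) = refl

basic-sound : ∀ {A} → A Data.List.Membership.Propositional.∈ basicAxioms → ∀ ρ → ⟦ A ⟧ ρ
basic-sound (here refl) ρ = refl
basic-sound (there (here refl)) ρ p q = trans (sym p) q
basic-sound (there (there (here refl))) ρ p = cong suc p
basic-sound (there (there (there (here refl)))) ρ p q = cong₂ _+_ p q
basic-sound (there (there (there (there (here refl))))) ρ p q = cong₂ _*_ p q
basic-sound (there (there (there (there (there (here refl)))))) ρ ()
basic-sound (there (there (there (there (there (there (here refl))))))) ρ p = suc-injective p
basic-sound (there (there (there (there (there (there (there (here refl)))))))) ρ = +-identityʳ (ρ 0)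
basic-sound (there (there (there (there (there (there (there (there (here refl))))))))) ρ = +-suc (ρ 0) (ρ 1)
basic-sound (there (there (there (there (there (there (there (there (there (here refl)))))))))) ρ = *-zeroʳ (ρ 0)
basic-sound (there (there (there (there (there (there (there (there (there (there (here refl))))))))))) ρ =
  trans (*-suc (ρ 0) (ρ 1)) (+-comm (ρ 0) _)

soundness : ∀ {A} → PA⊢ A → ∀ ρ → ⟦ A ⟧ ρ
soundness (basic p) ρ = basic-sound p ρ
soundness ax-K ρ a b = a
soundness ax-S ρ f g a = f a (g a)
soundness (ax-DN {A}) ρ h = ⟦⟧-stable A h
soundness (ax-inst {A} t) ρ h = ⟦[]⟧⇐ A (inst t) (⟦⟧-cong A (sym ∘ eval-inst ρ t) (h (eval ρ t)))
soundness ax-dist ρ f a n = f n (a n)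
soundness (ax-vac {A}) ρ a n = ⟦[]⟧⇐ A shift a
soundness (induction {A}) ρ z s zero =
  ⟦⟧-cong A (eval-inst ρ 𝟎) (⟦[]⟧⇒ A (inst 𝟎) z)
soundness (induction {A}) ρ z s (suc n) =
  ⟦⟧-cong A (eval-step ρ n) (⟦[]⟧⇒ A step (s n (soundness (induction {A}) ρ z s n)))
soundness (mp p q) ρ = soundness q ρ (soundness p ρ)
soundness (gen p) ρ n = soundness p (n ∷ᵉ ρ)

⟦inst⟧⇒ : ∀ A t {ρ} → ⟦ A [ inst t ] ⟧ ρ → ⟦ A ⟧ (eval ρ t ∷ᵉ ρ)
⟦inst⟧⇒ A t {ρ} h = ⟦⟧-cong A (eval-inst ρ t) (⟦[]⟧⇒ A (inst t) h)

-- Derived rules of the Hilbert calculus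

ap : ∀ {A B C} → PA⊢ C ⇒ A ⇒ B → PA⊢ C ⇒ A → PA⊢ C ⇒ B
ap f a = mp a (mp f ax-S)

const : ∀ {A B} → PA⊢ A → PA⊢ B ⇒ A
const a = mp a ax-K

identity : ∀ {A} → PA⊢ A ⇒ A
identity {A} = ap (ax-K {A} {A ⇒ A}) (ax-K {A} {A})

exfalso : ∀ {A} → PA⊢ ⊥̇ ⇒ A
exfalso {A} = ap (const ax-DN) (ax-K {⊥̇} {~ A})

~~-intro : ∀ {A} → PA⊢ A → PA⊢ ~ ~ A
~~-intro {A} a = ap identity (const a)

⇒-trans : ∀ {A B C} → PA⊢ A ⇒ B → PA⊢ B ⇒ C → PA⊢ A ⇒ C
⇒-trans {A} f g = ap (const g) f

contrapose : ∀ {A B} → PA⊢ A ⇒ B → PA⊢ ~ B → PA⊢ ~ A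
contrapose = ⇒-trans

specialize : ∀ {A} t → PA⊢ all A → PA⊢ A [ inst t ]
specialize t a = mp a (ax-inst t)

∃-intro : ∀ {A} t → PA⊢ A [ inst t ] → PA⊢ ~ all (~ A)
∃-intro {A} t a = ⇒-trans (ax-inst t) (~~-intro a)

-- Variables are instantiated one at a time, and each `inst` lowers the remaining indices; the
-- raises shield a term already put in from the instantiations still to come. Four terms suffice
-- because no basic axiom has more than four variables.
instances : ∀ {A} → PA⊢ A → ∀ t₀ t₁ t₂ t₃ → PA⊢ A ∙ (t₀ ∷ᵉ t₁ ∷ᵉ t₂ ∷ᵉ t₃ ∷ᵉ var)
instances {A} a t₀ t₁ t₂ t₃ = subst PA⊢_ eq
  (specialize t₃ (gen (specialize (raise t₂) (gen (specialize (raise (raise t₁))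
    (gen (specialize (raise (raise (raise t₀))) (gen a))))))))
  where
  s₀ = raise (raise (raise t₀))
  f : ℕ → Term
  f i = (inst s₀ at i) [ inst (raise (raise t₁)) ]ᵗ [ inst (raise t₂) ]ᵗ [ inst t₃ ]ᵗ
  pointwise : ∀ i → f i ≡ (t₀ ∷ᵉ t₁ ∷ᵉ t₂ ∷ᵉ t₃ ∷ᵉ var) i
  pointwise 0 = trans (cong (λ t → t [ inst (raise t₂) ]ᵗ [ inst t₃ ]ᵗ) (raise-inst (raise (raise t₀)) _))
               (trans (cong _[ inst t₃ ]ᵗ (raise-inst (raise t₀) _)) (raise-inst t₀ _))
  pointwise 1 = trans (cong _[ inst t₃ ]ᵗ (raise-inst (raise t₁) _)) (raise-inst t₁ _)
  pointwise 2 = raise-inst t₂ _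
  pointwise 3 = refl
  pointwise (suc (suc (suc (suc i)))) = refl
  eq : A [ inst s₀ ] [ inst (raise (raise t₁)) ] [ inst (raise t₂) ] [ inst t₃ ]
     ≡ A ∙ (t₀ ∷ᵉ t₁ ∷ᵉ t₂ ∷ᵉ t₃ ∷ᵉ var)
  eq = trans (cong (λ B → B [ _ ] [ _ ] [ _ ]) ([]-∙ (inst s₀) A))
      (trans (cong (λ B → B [ _ ] [ _ ]) (∙-[] _ _ A))
      (trans (cong (λ B → B [ _ ]) (∙-[] _ _ A))
      (trans (∙-[] _ _ A) (∙-cong pointwise A))))

-- Equality and numerals in PA

≐-refl : ∀ t → PA⊢ t ≐ t
≐-refl t = instances (basic (here refl)) t t t t

≐-cancel : ∀ {s t u} → PA⊢ s ≐ t ⇒ s ≐ u ⇒ t ≐ u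
≐-cancel {s} {t} {u} = instances (basic (there (here refl))) s t u u

≐-swap : ∀ {s t} → PA⊢ s ≐ t ⇒ t ≐ s
≐-swap = ap ≐-cancel (const (≐-refl _))

≐-sym : ∀ {s t} → PA⊢ s ≐ t → PA⊢ t ≐ s
≐-sym p = mp p ≐-swap

≐-replace : ∀ {s t u v} → PA⊢ s ≐ t → PA⊢ u ≐ v → PA⊢ s ≐ u ⇒ t ≐ v
≐-replace p q = ap (⇒-trans (⇒-trans (mp p ≐-cancel) ≐-swap) ≐-cancel) (const q)

≐-trans : ∀ {s t u} → PA⊢ s ≐ t → PA⊢ t ≐ u → PA⊢ s ≐ u
≐-trans p q = mp q (mp (≐-sym p) ≐-cancel)

S-cong : ∀ {s t} → PA⊢ s ≐ t → PA⊢ S s ≐ S t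
S-cong {s} {t} p = mp p (instances (basic (there (there (here refl)))) s t t t)

⊕-cong : ∀ {s t u v} → PA⊢ s ≐ t → PA⊢ u ≐ v → PA⊢ s ⊕ u ≐ t ⊕ v
⊕-cong {s} {t} {u} {v} p q =
  mp q (mp p (instances (basic (there (there (there (here refl))))) s t u v))

⊗-cong : ∀ {s t u v} → PA⊢ s ≐ t → PA⊢ u ≐ v → PA⊢ s ⊗ u ≐ t ⊗ v
⊗-cong {s} {t} {u} {v} p q =
  mp q (mp p (instances (basic (there (there (there (there (here refl)))))) s t u v))

S≢𝟎 : ∀ t → PA⊢ ~ (S t ≐ 𝟎)
S≢𝟎 t = instances (basic (there (there (there (there (there (here refl))))))) t t t t

S-injective : ∀ {s t} → PA⊢ S s ≐ S t ⇒ s ≐ t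
S-injective {s} {t} =
  instances (basic (there (there (there (there (there (there (here refl)))))))) s t t t

⊕-𝟎 : ∀ t → PA⊢ t ⊕ 𝟎 ≐ t
⊕-𝟎 t = instances (basic (there (there (there (there (there (there (there (here refl))))))))) t t t t

⊕-S : ∀ s t → PA⊢ s ⊕ S t ≐ S (s ⊕ t)
⊕-S s t =
  instances (basic (there (there (there (there (there (there (there (there (here refl)))))))))) s t t t

⊗-𝟎 : ∀ t → PA⊢ t ⊗ 𝟎 ≐ 𝟎
⊗-𝟎 t =
  instances (basic (there (there (there (there (there (there (there (there (there (here refl)))))))))))
    t t t t

⊗-S : ∀ s t → PA⊢ s ⊗ S t ≐ s ⊗ t ⊕ s
⊗-S s t =
  instances (basic (there (there (there (there (there (there (there (there (there (there (here refl))))))))))))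
    s t t t

⊕-numeral : ∀ m n → PA⊢ numeral m ⊕ numeral n ≐ numeral (m + n)
⊕-numeral m zero    = subst (λ k → PA⊢ numeral m ⊕ 𝟎 ≐ numeral k) (sym (+-identityʳ m)) (⊕-𝟎 _)
⊕-numeral m (suc n) = subst (λ k → PA⊢ numeral m ⊕ numeral (suc n) ≐ numeral k) (sym (+-suc m n))
  (≐-trans (⊕-S _ _) (S-cong (⊕-numeral m n)))

⊗-numeral : ∀ m n → PA⊢ numeral m ⊗ numeral n ≐ numeral (m * n)
⊗-numeral m zero    = subst (λ k → PA⊢ numeral m ⊗ 𝟎 ≐ numeral k) (sym (*-zeroʳ m)) (⊗-𝟎 _)
⊗-numeral m (suc n) = subst (λ k → PA⊢ numeral m ⊗ numeral (suc n) ≐ numeral k)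
  (trans (+-comm (m * n) m) (sym (*-suc m n)))
  (≐-trans (⊗-S _ _) (≐-trans (⊕-cong (⊗-numeral m n) (≐-refl _)) (⊕-numeral (m * n) m)))

eval-provable : ∀ ρ t → PA⊢ substVars (numeral ∘ ρ) t ≐ numeral (eval ρ t)
eval-provable ρ (var i) = ≐-refl _
eval-provable ρ 𝟎       = ≐-refl _
eval-provable ρ (S t)   = S-cong (eval-provable ρ t)
eval-provable ρ (t ⊕ u) =
  ≐-trans (⊕-cong (eval-provable ρ t) (eval-provable ρ u)) (⊕-numeral (eval ρ t) (eval ρ u))
eval-provable ρ (t ⊗ u) =
  ≐-trans (⊗-cong (eval-provable ρ t) (eval-provable ρ u)) (⊗-numeral (eval ρ t) (eval ρ u))

numeral-≢ : ∀ m n → m ≢ n → PA⊢ ~ (numeral m ≐ numeral n)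
numeral-≢ zero    zero    m≢n = ⊥-elim (m≢n refl)
numeral-≢ (suc m) zero    m≢n = S≢𝟎 _
numeral-≢ zero    (suc n) m≢n = contrapose ≐-swap (S≢𝟎 (numeral n))
numeral-≢ (suc m) (suc n) m≢n = contrapose S-injective (numeral-≢ m n (m≢n ∘ cong suc))

-- Finite case distinctions and Δ₀ decidability

S^ : ℕ → Term → Term
S^ zero    t = t
S^ (suc n) t = S S^ n t

⊕-S^ : ∀ s n t → PA⊢ s ⊕ S^ n t ≐ S^ n (s ⊕ t)
⊕-S^ s zero    t = ≐-refl _
⊕-S^ s (suc n) t = ≐-trans (⊕-S _ _) (S-cong (⊕-S^ s n t))

S^≢numeral : ∀ {n N} t → n < N → PA⊢ ~ (S^ N t ≐ numeral n)
S^≢numeral {zero}  {suc N} t n<N       = S≢𝟎 _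
S^≢numeral {suc n} {suc N} t (s≤s n<N) = contrapose S-injective (S^≢numeral t n<N)

numeral-S^ : ∀ n → numeral n ≡ S^ n 𝟎
numeral-S^ zero    = refl
numeral-S^ (suc n) = cong S_ (numeral-S^ n)

substVars-S^ : ∀ f n t → substVars f (S^ n t) ≡ S^ n (substVars f t)
substVars-S^ f zero    t = refl
substVars-S^ f (suc n) t = cong S_ (substVars-S^ f n t)

step^ : ℕ → ℕ → Term
step^ n = S^ n (var 0) ∷ᵉ λ i → var (suc i)

∙-var : ∀ A → A ∙ var ≡ A
∙-var (t ≐ u) = cong₂ _≐_ (substVars-var t) (substVars-var u)
∙-var ⊥̇       = refl
∙-var (A ⇒ B) = cong₂ _⇒_ (∙-var A) (∙-var B)
∙-var (all A) = cong all (trans (∙-cong (λ { zero → refl ; (suc i) → refl }) A) (∙-var A))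

step-inst : ∀ A t → A [ step ] [ inst t ] ≡ A [ inst (S t) ]
step-inst A t = trans (cong _[ inst t ] ([]-∙ step A)) (trans (∙-[] _ _ A)
  (trans (∙-cong (λ { zero → refl ; (suc i) → refl }) A) (sym ([]-∙ (inst (S t)) A))))

step-step^ : ∀ n A → A [ step ] ∙ step^ n ≡ A ∙ step^ (suc n)
step-step^ n A = trans (cong (_∙ step^ n) ([]-∙ step A)) (trans (∙-∘ _ _ A)
  (∙-cong (λ { zero → refl ; (suc i) → refl }) A))

-- Induction serves as mere case distinction between 0 and successors: `ax-K` discards the induction
-- hypothesis, since the recursive call proves `A [ step ]` outright. This spares a proof inside PA
-- that x < N is a finite disjunction.
cases : ∀ N A → (∀ k → k < N → PA⊢ A [ inst (numeral k) ]) → PA⊢ A ∙ step^ N → PA⊢ all A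
cases zero    A below above =
  gen (subst PA⊢_ (trans (∙-cong (λ { zero → refl ; (suc i) → refl }) A) (∙-var A)) above)
cases (suc N) A below above =
  mp (mp successor (mp (gen ax-K) ax-dist)) (mp (below 0 (s≤s z≤n)) induction)
  where
  successor : PA⊢ all (A [ step ])
  successor = cases N (A [ step ])
    (λ k k<N → subst PA⊢_ (sym (step-inst A (numeral k))) (below (suc k) (s≤s k<N)))
    (subst PA⊢_ (sym (step-step^ N A)) above)

-- all≤ j A is ∀ x₀ ≤ xⱼ A, with xⱼ taken outside of the quantifier.

infix 26 _≤ᵗ_

_≤ᵗ_ : Term → Term → Formula
s ≤ᵗ t = ~ all (~ (var 0 ⊕ raise s ≐ raise t))

all≤ : ℕ → Formula → Formula
all≤ j A = all (var 0 ≤ᵗ var (suc j) ⇒ A)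

data Δ₀ : Formula → Set where
  equation : ∀ {t u} → Δ₀ (t ≐ u)
  falsity  : Δ₀ ⊥̇
  implies  : ∀ {A B} → Δ₀ A → Δ₀ B → Δ₀ (A ⇒ B)
  bounded  : ∀ {j A} → Δ₀ A → Δ₀ (all≤ j A)

Decided : Formula → Set
Decided A = PA⊢ A ⊎ PA⊢ ~ A

_⟨_⟩ : Formula → Env → Formula
A ⟨ ρ ⟩ = A ∙ (numeral ∘ ρ)

infixl 31 _⟨_⟩

⟨⟩-inst : ∀ A ρ k → A ∙ exts (numeral ∘ ρ) [ inst (numeral k) ] ≡ A ⟨ k ∷ᵉ ρ ⟩
⟨⟩-inst A ρ k = trans (∙-exts-inst _ _ A) (∙-cong (λ { zero → refl ; (suc i) → refl }) A)

⟨⟩-sound : ∀ A {ρ} → PA⊢ A ⟨ ρ ⟩ → ⟦ A ⟧ ρ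
⟨⟩-sound A {ρ} p =
  ⟦⟧-cong A (λ i → eval-numeral (λ _ → 0) (ρ i)) (⟦∙⟧⇒ A (soundness p (λ _ → 0)))

⟨⟩-refuted : ∀ A {ρ} → PA⊢ ~ (A ⟨ ρ ⟩) → ¬ ⟦ A ⟧ ρ
⟨⟩-refuted A = ⟨⟩-sound (~ A)

numeral-≤ : ∀ {k n} → k ≤ n → PA⊢ numeral k ≤ᵗ numeral n
numeral-≤ {k} {n} k≤n = ∃-intro (numeral (n ∸ k))
  (subst₂ (λ s t → PA⊢ numeral (n ∸ k) ⊕ s ≐ t) (sym (raise-inst _ _)) (sym (raise-inst _ _))
    (subst (λ m → PA⊢ numeral (n ∸ k) ⊕ numeral k ≐ numeral m) (m∸n+n≡m k≤n)
      (⊕-numeral (n ∸ k) k)))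

numeral-≤-S^ : ∀ n t → PA⊢ numeral n ≤ᵗ S^ n t
numeral-≤-S^ n t = ∃-intro t
  (subst₂ (λ s u → PA⊢ t ⊕ s ≐ u) (sym (raise-inst _ _)) (sym (raise-inst _ _))
    (subst (λ s → PA⊢ t ⊕ s ≐ S^ n t) (sym (numeral-S^ n))
      (≐-trans (⊕-S^ t n 𝟎) (S^-cong n (⊕-𝟎 t)))))
  where
  S^-cong : ∀ {s t} n → PA⊢ s ≐ t → PA⊢ S^ n s ≐ S^ n t
  S^-cong zero    p = p
  S^-cong (suc n) p = S-cong (S^-cong n p)

S^-≰-numeral : ∀ {n N} t → n < N → PA⊢ ~ (S^ N t ≤ᵗ numeral n)
S^-≰-numeral {n} {N} t n<N = ~~-intro (gen
  (subst₂ (λ s u → PA⊢ ~ (var 0 ⊕ s ≐ u))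
    (sym (substVars-S^ _ N t)) (sym (substVars-numeral _ n))
    (contrapose (mp (⊕-S^ (var 0) N (raise t)) ≐-cancel) (S^≢numeral (var 0 ⊕ raise t) n<N))))

module _ (j : ℕ) (A : Formula) (ρ : Env) where

  private
    C : Formula
    C = (var 0 ≤ᵗ var (suc j) ⇒ A) ∙ exts (numeral ∘ ρ)

    C-inst : ∀ k → C [ inst (numeral k) ] ≡ (numeral k ≤ᵗ numeral (ρ j) ⇒ A ⟨ k ∷ᵉ ρ ⟩)
    C-inst k = ⟨⟩-inst (var 0 ≤ᵗ var (suc j) ⇒ A) ρ k

    C-step : ∀ N → C ∙ step^ N ≡
      (S^ N (var 0) ≤ᵗ numeral (ρ j) ⇒ A ∙ exts (numeral ∘ ρ) ∙ step^ N)
    C-step N = cong (λ t → ~ all (~ (var 0 ⊕ raise (S^ N (var 0)) ≐ t)) ⇒ A ∙ exts (numeral ∘ ρ) ∙ step^ N)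
      (trans (cong (substVars (exts (step^ N)))
        (trans (cong raise (substVars-numeral _ (ρ j))) (substVars-numeral _ (ρ j))))
        (trans (substVars-numeral _ (ρ j)) (sym (substVars-numeral _ (ρ j)))))

  -- `cases` splits at ρ j + 1: up to ρ j the instances are given, and from ρ j + 1 on the bound
  -- itself is refutable.
  all≤-intro : (∀ k → k ≤ ρ j → PA⊢ A ⟨ k ∷ᵉ ρ ⟩) → PA⊢ all≤ j A ⟨ ρ ⟩
  all≤-intro h = cases (suc (ρ j)) C
    (λ k k≤ → subst PA⊢_ (sym (C-inst k)) (mp (h k (≤-pred k≤)) ax-K))
    (subst PA⊢_ (sym (C-step (suc (ρ j))))
      (⇒-trans (S^-≰-numeral {ρ j} (var 0) ≤-refl) exfalso))

  all≤-elim : ∀ k → k ≤ ρ j → PA⊢ all≤ j A ⟨ ρ ⟩ ⇒ A ⟨ k ∷ᵉ ρ ⟩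
  all≤-elim k k≤ = ap
    (subst (λ D → PA⊢ all C ⇒ D) (C-inst k) (ax-inst (numeral k)))
    (const (numeral-≤ k≤))

  all≤-decided : (∀ k → Decided (A ⟨ k ∷ᵉ ρ ⟩)) → Decided (all≤ j A ⟨ ρ ⟩)
  all≤-decided dec = [ (λ h → inj₁ (all≤-intro λ k k≤ → h k (s≤s k≤))) , inj₂ ]′ (search (suc (ρ j)) ≤-refl)
    where
    search : ∀ n → n ≤ suc (ρ j) → (∀ k → k < n → PA⊢ A ⟨ k ∷ᵉ ρ ⟩) ⊎ PA⊢ ~ (all≤ j A ⟨ ρ ⟩)
    search zero    _       = inj₁ λ _ ()
    search (suc n) (s≤s n≤) with search n (m≤n⇒m≤1+n n≤) | dec n
    ... | inj₂ r | _      = inj₂ r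
    ... | inj₁ h | inj₂ r = inj₂ (contrapose (all≤-elim n n≤) r)
    ... | inj₁ h | inj₁ p = inj₁ λ k k≤ → [ (λ k< → h k (≤-pred k<)) , (λ { refl → p }) ]′ (m≤n⇒m<n∨m≡n k≤)

decide : ∀ {A} → Δ₀ A → ∀ ρ → Decided (A ⟨ ρ ⟩)
decide (equation {t} {u}) ρ with eval ρ t ≟ eval ρ u
... | yes e = inj₁ (≐-trans (eval-provable ρ t)
                (≐-sym (subst (λ n → PA⊢ substVars (numeral ∘ ρ) u ≐ numeral n) (sym e) (eval-provable ρ u))))
... | no ¬e = inj₂ (contrapose (≐-replace (eval-provable ρ t) (eval-provable ρ u)) (numeral-≢ _ _ ¬e))
decide falsity ρ = inj₂ identity
decide (implies p q) ρ with decide p ρ | decide q ρ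
... | _      | inj₁ b = inj₁ (mp b ax-K)
... | inj₂ a | inj₂ _ = inj₁ (⇒-trans a exfalso)
... | inj₁ a | inj₂ b = inj₂ (ap (const b) (ap identity (const a)))
decide (bounded {j} {A} p) ρ = all≤-decided j A ρ λ k → decide p (k ∷ᵉ ρ)

-- No induction on truth: PA decides the instance, and by soundness it cannot refute a true one.
decide-true : ∀ {A} → Δ₀ A → ∀ {ρ} → ⟦ A ⟧ ρ → PA⊢ A ⟨ ρ ⟩
decide-true {A} p {ρ} h with decide p ρ
... | inj₁ a = a
... | inj₂ a = ⊥-elim (⟨⟩-refuted A a h)

decide-false : ∀ {A} → Δ₀ A → ∀ {ρ} → ¬ ⟦ A ⟧ ρ → PA⊢ ~ (A ⟨ ρ ⟩)
decide-false p = decide-true (implies p falsity)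

-- Σ₁ formulas over an abstract logic

-- Universal quantifiers occur only with a bound, so whatever is written over a `Logic` is Σ₁. The
-- level is there because the semantic formulas are types.
record Logic ℓ : Set (lsuc ℓ) where
  infixl 28 _+̇_
  infixl 29 _*̇_
  infix  26 _=̇_
  infixr 24 _∧̇_
  infixr 23 _∨̇_
  field
    Tm : Set
    Fm : Set ℓ
    num : ℕ → Tm
    suċ : Tm → Tm
    _+̇_ _*̇_ pair : Tm → Tm → Tm
    _=̇_ : Tm → Tm → Fm
    falsum : Fm
    _∧̇_ _∨̇_ : Fm → Fm → Fm
    ∃̇ : (Tm → Fm) → Fm
    ∀≤ : Tm → (Tm → Fm) → Fm

-- The formulas of Defs over any logic.  Below they are built as Σ₁ data, which can be bounded and
-- evaluated, and as types, where they are plain statements about numbers.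

module Arithmetic {ℓ} (L : Logic ℓ) where

  open Logic L
  open Defs.Coding num pair public hiding (codeᵗ; code)

  infix 26 _≤̇_ _<̇_

  ⋁ : List Fm → Fm
  ⋁ = foldr _∨̇_ falsum

  _≤̇_ _<̇_ : Tm → Tm → Fm
  s ≤̇ t = ∃̇ λ k → k +̇ s =̇ t
  s <̇ t = suċ s ≤̇ t

  Entry : Tm → Tm → Tm → Fm
  Entry s i y = ∃̇ λ a → ∃̇ λ b → ∃̇ λ q →
    s =̇ pair a b ∧̇ a =̇ q *̇ suċ (suċ i *̇ b) +̇ y ∧̇ y <̇ suċ (suċ i *̇ b)

  Rule : Set ℓ
  Rule = (earlier : Tm → Fm) → Tm → Fm

  Derivation : Rule → Tm → Tm → Tm → Fm
  Derivation R s n y =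
    Entry s n y ∧̇
    ∀≤ n λ i → ∃̇ λ z → Entry s i z ∧̇ R (λ w → ∃̇ λ j → j <̇ i ∧̇ Entry s j w) z

  Generated : Rule → Tm → Fm
  Generated R y = ∃̇ λ s → ∃̇ λ n → Derivation R s n y

  term form : Tm → Tm
  term t = pair (num 0) t
  form a = pair (num 1) a

  formationRule : Rule
  formationRule earlier y = ⋁
    ( (∃̇ λ i → y =̇ term (cvar i))
    ∷ (y =̇ term czero)
    ∷ (∃̇ λ t → earlier (term t) ∧̇ y =̇ term (cS t))
    ∷ (∃̇ λ t → ∃̇ λ u → earlier (term t) ∧̇ earlier (term u) ∧̇ y =̇ term (cplus t u))
    ∷ (∃̇ λ t → ∃̇ λ u → earlier (term t) ∧̇ earlier (term u) ∧̇ y =̇ term (ctimes t u))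
    ∷ (∃̇ λ t → ∃̇ λ u → earlier (term t) ∧̇ earlier (term u) ∧̇ y =̇ form (ceq t u))
    ∷ (y =̇ form cbot)
    ∷ (∃̇ λ a → ∃̇ λ b → earlier (form a) ∧̇ earlier (form b) ∧̇ y =̇ form (cimp a b))
    ∷ (∃̇ λ a → earlier (form a) ∧̇ y =̇ form (call a))
    ∷ [])

  IsTerm IsFormula : Tm → Fm
  IsTerm t    = Generated formationRule (term t)
  IsFormula a = Generated formationRule (form a)

  sub : Tm → Tm → Tm → Tm
  sub σ a b = pair σ (pair a b)

  binary : (Tm → Tm → Tm) → Rule
  binary op earlier y =
    ∃̇ λ σ → ∃̇ λ a → ∃̇ λ b → ∃̇ λ a′ → ∃̇ λ b′ →
      earlier (sub σ a a′) ∧̇ earlier (sub σ b b′) ∧̇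
      y =̇ sub σ (op a b) (op a′ b′)

  substRule : Rule
  substRule earlier y = ⋁
    ( (∃̇ λ i → y =̇ sub cshift (cvar i) (cvar (suċ i)))
    ∷ (∃̇ λ t → y =̇ sub (cinst t) (cvar (num 0)) t)
    ∷ (∃̇ λ t → ∃̇ λ i → y =̇ sub (cinst t) (cvar (suċ i)) (cvar i))
    ∷ (y =̇ sub cstep (cvar (num 0)) (cS (cvar (num 0))))
    ∷ (∃̇ λ i → y =̇ sub cstep (cvar (suċ i)) (cvar (suċ i)))
    ∷ (∃̇ λ σ → y =̇ sub (clift σ) (cvar (num 0)) (cvar (num 0)))
    ∷ (∃̇ λ σ → ∃̇ λ i → ∃̇ λ t → ∃̇ λ u →
         earlier (sub σ (cvar i) t) ∧̇ earlier (sub cshift t u) ∧̇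
         y =̇ sub (clift σ) (cvar (suċ i)) u)
    ∷ (∃̇ λ σ → y =̇ sub σ czero czero)
    ∷ (∃̇ λ σ → ∃̇ λ t → ∃̇ λ u → earlier (sub σ t u) ∧̇ y =̇ sub σ (cS t) (cS u))
    ∷ binary cplus earlier y
    ∷ binary ctimes earlier y
    ∷ binary ceq earlier y
    ∷ (∃̇ λ σ → y =̇ sub σ cbot cbot)
    ∷ binary cimp earlier y
    ∷ (∃̇ λ σ → ∃̇ λ a → ∃̇ λ b →
         earlier (sub (clift σ) a b) ∧̇ y =̇ sub σ (call a) (call b))
    ∷ [])

  SubstitutesTo : Tm → Tm → Tm → Fm
  SubstitutesTo σ a b = Generated substRule (sub σ a b)

  numeralRule : Rule
  numeralRule earlier y = ⋁
    ( (y =̇ pair (num 0) czero)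
    ∷ (∃̇ λ n → ∃̇ λ u → earlier (pair n u) ∧̇ y =̇ pair (suċ n) (cS u))
    ∷ [])

  NumeralCode : Tm → Tm → Fm
  NumeralCode n u = Generated numeralRule (pair n u)

  proofRule : Rule
  proofRule earlier y = ⋁
    ( ⋁ (map (λ A → y =̇ num ⌜ A ⌝) basicAxioms)
    ∷ (∃̇ λ a → ∃̇ λ b → IsFormula a ∧̇ IsFormula b ∧̇ y =̇ cimp a (cimp b a))
    ∷ (∃̇ λ a → ∃̇ λ b → ∃̇ λ c → IsFormula a ∧̇ IsFormula b ∧̇ IsFormula c ∧̇
         y =̇ cimp (cimp a (cimp b c)) (cimp (cimp a b) (cimp a c)))
    ∷ (∃̇ λ a → IsFormula a ∧̇ y =̇ cimp (cimp (cimp a cbot) cbot) a)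
    ∷ (∃̇ λ a → ∃̇ λ t → ∃̇ λ b → IsFormula a ∧̇ IsTerm t ∧̇
         SubstitutesTo (cinst t) a b ∧̇ y =̇ cimp (call a) b)
    ∷ (∃̇ λ a → ∃̇ λ b → IsFormula a ∧̇ IsFormula b ∧̇
         y =̇ cimp (call (cimp a b)) (cimp (call a) (call b)))
    ∷ (∃̇ λ a → ∃̇ λ b → IsFormula a ∧̇
         SubstitutesTo cshift a b ∧̇ y =̇ cimp a (call b))
    ∷ (∃̇ λ a → ∃̇ λ b → ∃̇ λ c → IsFormula a ∧̇
         SubstitutesTo (cinst czero) a b ∧̇ SubstitutesTo cstep a c ∧̇
         y =̇ cimp b (cimp (call (cimp a c)) (call a)))
    ∷ (∃̇ λ a → earlier a ∧̇ earlier (cimp a y))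
    ∷ (∃̇ λ a → earlier a ∧̇ y =̇ call a)
    ∷ [])

  Proof : Tm → Tm → Fm
  Proof x y = ∃̇ λ s → ∃̇ λ n → x =̇ pair s n ∧̇ Derivation proofRule s n y

  Provable : Tm → Fm
  Provable y = ∃̇ λ x → Proof x y

  Box : Tm → Tm → Fm
  Box x g = ∃̇ λ u → ∃̇ λ z →
    NumeralCode x u ∧̇ SubstitutesTo (cinst u) g z ∧̇ Provable z

  -- The codes p and b of templates of x: F and □ G yield the codes ⌜ □^ n (~ (x: F)) ⌝,
  -- where f is the code of F.
  cfRule : ℕ → ℕ → Tm → Rule
  cfRule p b f earlier y = ⋁
    ( (∃̇ λ u → ∃̇ λ t → NumeralCode f u ∧̇ SubstitutesTo (clift (cinst u)) (num p) t ∧̇ y =̇ cimp t cbot)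
    ∷ (∃̇ λ g → ∃̇ λ u → earlier g ∧̇ NumeralCode g u ∧̇ SubstitutesTo (clift (cinst u)) (num b) y)
    ∷ [])

  -- f′ will be the code of a formula contradicting the one coded by f.
  Refuted : ℕ → ℕ → Tm → Tm → Fm
  Refuted p b f f′ = ∃̇ λ y →
    (y =̇ f′ ∨̇ (∃̇ λ c → Generated (cfRule p b f) c ∧̇ y =̇ call c)) ∧̇ Provable y

  -- Gödel's diagonal function: the numeral of x is put for the variable x₀ of the formula that x
  -- itself codes.
  Diagonal : Tm → Tm → Fm
  Diagonal x f = ∃̇ λ u → NumeralCode x u ∧̇ SubstitutesTo (cinst u) x f

  -- The formula contradicting `~ A` is taken to be `A` rather than `~ ~ A`, so that a proof of `A`
  -- directly counts as a refutation of `~ A`.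
  RefutedDiagonal RefutedNegation : ℕ → ℕ → Tm → Fm
  RefutedDiagonal p b x = ∃̇ λ f → Diagonal x f ∧̇ Refuted p b f (cimp f cbot)
  RefutedNegation p b x = ∃̇ λ f → Diagonal x f ∧̇ Refuted p b (cimp f cbot) f

-- Σ₁ formulas as data.  As in Defs, `lv l` is the variable bound by the (l+1)-st
-- enclosing quantifier.

data LTm : Set where
  lv   : ℕ → LTm
  lnum : ℕ → LTm
  lS : LTm → LTm
  lplus ltimes lpair : LTm → LTm → LTm

data Σ₁ : Set where
  equ  : LTm → LTm → Σ₁
  bot : Σ₁
  and or : Σ₁ → Σ₁ → Σ₁
  ex  : Σ₁ → Σ₁
  ball : ℕ → Σ₁ → Σ₁

-- Quantifiers are only ever bounded by variables; the other case is junk.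
ballOf : LTm → Σ₁ → Σ₁
ballOf (lv l) A = ball l A
ballOf _      A = bot

syntactic : Logic 0ℓ
syntactic = record
  { Tm = LTm ; Fm = ℕ → Σ₁ ; num = lnum ; suċ = lS ; _+̇_ = lplus ; _*̇_ = ltimes ; pair = lpair
  ; _=̇_ = λ s t d → equ s t ; falsum = λ d → bot
  ; _∧̇_ = λ A B d → and (A d) (B d) ; _∨̇_ = λ A B d → or (A d) (B d)
  ; ∃̇ = λ A d → ex (A (lv d) (suc d)) ; ∀≤ = λ n A d → ballOf n (A (lv d) (suc d)) }

semantic : Logic (lsuc 0ℓ)
semantic = record
  { Tm = ℕ ; Fm = Set ; num = id ; suċ = suc ; _+̇_ = _+_ ; _*̇_ = _*_ ; pair = ⟪_,_⟫
  ; _=̇_ = _≡_ ; falsum = ⊥ ; _∧̇_ = _×_ ; _∨̇_ = _⊎_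
  ; ∃̇ = Σ ℕ ; ∀≤ = λ n A → ∀ i → i ≤ n → A i }

module Syn = Arithmetic syntactic
module Val = Arithmetic semantic

emb : LTm → Defs.Tm
emb (lv l)       = bound l
emb (lnum n)     = Defs.num n
emb (lS t)    = Defs.suċ (emb t)
emb (lplus s t)  = emb s Defs.+̇ emb t
emb (ltimes s t) = emb s Defs.*̇ emb t
emb (lpair s t)  = ⟨ emb s , emb t ⟩

-- Each connective is rendered by the very combinator used in the definitions of `x: F` and `□ G`,
-- so that these are translations of `Σ₁` data by mere computation.
⌊_⌋ : Σ₁ → Defs.Fm
⌊ equ s t ⌋   = emb s Defs.=̇ emb t
⌊ bot ⌋      = λ _ → ⊥̇
⌊ and A B ⌋  = ⌊ A ⌋ Defs.∧̇ ⌊ B ⌋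
⌊ or A B ⌋   = ⌊ A ⌋ Defs.∨̇ ⌊ B ⌋
⌊ ex A ⌋     = Defs.∃̇ λ _ → ⌊ A ⌋
⌊ ball l A ⌋ = Defs.∀̇ λ i → i Defs.≤̇ bound l Defs.⇒̇ ⌊ A ⌋

-- Truth and scoping of Σ₁ formulas

levelVal : ℕ → Env → LTm → ℕ
levelVal d ρ (lv l)       = ρ (d ∸ suc l)
levelVal d ρ (lnum n)     = n
levelVal d ρ (lS t)    = suc (levelVal d ρ t)
levelVal d ρ (lplus s t)  = levelVal d ρ s + levelVal d ρ t
levelVal d ρ (ltimes s t) = levelVal d ρ s * levelVal d ρ t
levelVal d ρ (lpair s t)  = ⟪ levelVal d ρ s , levelVal d ρ t ⟫

Holds : Σ₁ → ℕ → Env → Set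
Holds (equ s t) d ρ   = levelVal d ρ s ≡ levelVal d ρ t
Holds bot d ρ        = ⊥
Holds (and A B) d ρ  = Holds A d ρ × Holds B d ρ
Holds (or A B) d ρ   = Holds A d ρ ⊎ Holds B d ρ
Holds (ex A) d ρ     = Σ ℕ λ n → Holds A (suc d) (n ∷ᵉ ρ)
Holds (ball l A) d ρ = ∀ i → i ≤ ρ (d ∸ suc l) → Holds A (suc d) (i ∷ᵉ ρ)

Scopedᵗ : ℕ → LTm → Set
Scopedᵗ d (lv l)       = T (l <ᵇ d)
Scopedᵗ d (lnum n)     = ⊤
Scopedᵗ d (lS t)    = Scopedᵗ d t
Scopedᵗ d (lplus s t)  = Scopedᵗ d s × Scopedᵗ d t
Scopedᵗ d (ltimes s t) = Scopedᵗ d s × Scopedᵗ d t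
Scopedᵗ d (lpair s t)  = Scopedᵗ d s × Scopedᵗ d t

-- Level 0 is kept for a parameter, which never bounds a quantifier.
Scoped : ℕ → Σ₁ → Set
Scoped d (equ s t)         = Scopedᵗ d s × Scopedᵗ d t
Scoped d bot              = ⊤
Scoped d (and A B)        = Scoped d A × Scoped d B
Scoped d (or A B)         = Scoped d A × Scoped d B
Scoped d (ex A)           = Scoped (suc d) A
Scoped d (ball zero A)    = ⊥
Scoped d (ball (suc l) A) = T (suc l <ᵇ d) × Scoped (suc d) A

-- Level `w` will carry the bound that `cut` imposes, so the formula itself must not mention it.
Avoidsᵗ : ℕ → LTm → Set
Avoidsᵗ w (lv l)       = T (not (l ≡ᵇ w))
Avoidsᵗ w (lnum n)     = ⊤
Avoidsᵗ w (lS t)    = Avoidsᵗ w t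
Avoidsᵗ w (lplus s t)  = Avoidsᵗ w s × Avoidsᵗ w t
Avoidsᵗ w (ltimes s t) = Avoidsᵗ w s × Avoidsᵗ w t
Avoidsᵗ w (lpair s t)  = Avoidsᵗ w s × Avoidsᵗ w t

Avoids : ℕ → Σ₁ → Set
Avoids w (equ s t)   = Avoidsᵗ w s × Avoidsᵗ w t
Avoids w bot        = ⊤
Avoids w (and A B)  = Avoids w A × Avoids w B
Avoids w (or A B)   = Avoids w A × Avoids w B
Avoids w (ex A)     = Avoids w A
Avoids w (ball l A) = T (not (l ≡ᵇ w)) × Avoids w A

-- Deciding these syntactic properties lets evaluation check them for the large concrete formulas.
scopedᵗ? : ∀ d t → Dec (Scopedᵗ d t)
scopedᵗ? d (lv l)       = T? _
scopedᵗ? d (lnum n)     = yes tt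
scopedᵗ? d (lS t)       = scopedᵗ? d t
scopedᵗ? d (lplus s t)  = scopedᵗ? d s ×-dec scopedᵗ? d t
scopedᵗ? d (ltimes s t) = scopedᵗ? d s ×-dec scopedᵗ? d t
scopedᵗ? d (lpair s t)  = scopedᵗ? d s ×-dec scopedᵗ? d t

scoped? : ∀ d F → Dec (Scoped d F)
scoped? d (equ s t)        = scopedᵗ? d s ×-dec scopedᵗ? d t
scoped? d bot              = yes tt
scoped? d (and A B)        = scoped? d A ×-dec scoped? d B
scoped? d (or A B)         = scoped? d A ×-dec scoped? d B
scoped? d (ex A)           = scoped? (suc d) A
scoped? d (ball zero A)    = no id
scoped? d (ball (suc l) A) = T? _ ×-dec scoped? (suc d) A

avoidsᵗ? : ∀ w t → Dec (Avoidsᵗ w t)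
avoidsᵗ? w (lv l)       = T? _
avoidsᵗ? w (lnum n)     = yes tt
avoidsᵗ? w (lS t)       = avoidsᵗ? w t
avoidsᵗ? w (lplus s t)  = avoidsᵗ? w s ×-dec avoidsᵗ? w t
avoidsᵗ? w (ltimes s t) = avoidsᵗ? w s ×-dec avoidsᵗ? w t
avoidsᵗ? w (lpair s t)  = avoidsᵗ? w s ×-dec avoidsᵗ? w t

avoids? : ∀ w F → Dec (Avoids w F)
avoids? w (equ s t)  = avoidsᵗ? w s ×-dec avoidsᵗ? w t
avoids? w bot        = yes tt
avoids? w (and A B)  = avoids? w A ×-dec avoids? w B
avoids? w (or A B)   = avoids? w A ×-dec avoids? w B
avoids? w (ex A)     = avoids? w A
avoids? w (ball l A) = T? _ ×-dec avoids? w A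

≢-not-≡ᵇ : ∀ l w → T (not (l ≡ᵇ w)) → l ≢ w
≢-not-≡ᵇ (suc l) .(suc l) h refl = ≢-not-≡ᵇ l l h refl

index-suc : ∀ {l d} → l < d → suc d ∸ suc l ≡ suc (d ∸ suc l)
index-suc l<d = +-∸-assoc 1 l<d

-- A level out of scope is sent by truncated subtraction to index 0, which is still below d.
index-< : ∀ l {d} → 0 < d → d ∸ suc l < d
index-< l {suc d} _ = s≤s (m∸n≤m d l)

opaque
  unfolding ⟨_,_⟩ ⟪_,_⟫

  eval-emb : ∀ t {d ρ} → eval ρ (emb t d) ≡ levelVal d ρ t
  eval-emb (lv l)       = refl
  eval-emb (lnum n)     = eval-numeral _ n
  eval-emb (lS t)    = cong suc (eval-emb t)
  eval-emb (lplus s t)  = cong₂ _+_ (eval-emb s) (eval-emb t)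
  eval-emb (ltimes s t) = cong₂ _*_ (eval-emb s) (eval-emb t)
  eval-emb (lpair s t)  = cong₂ ⟪_,_⟫ (eval-emb s) (eval-emb t)

⟦all≤⟧⇒ : ∀ j A {ρ} → ⟦ all≤ j A ⟧ ρ → ∀ i → i ≤ ρ j → ⟦ A ⟧ (i ∷ᵉ ρ)
⟦all≤⟧⇒ j A {ρ} h i i≤ = h i λ k → k (ρ j ∸ i) (m∸n+n≡m i≤)

⟦all≤⟧⇐ : ∀ j A {ρ} → (∀ i → i ≤ ρ j → ⟦ A ⟧ (i ∷ᵉ ρ)) → ⟦ all≤ j A ⟧ ρ
⟦all≤⟧⇐ j A {ρ} h i i≤ =
  h i (decidable-stable (i ≤? ρ j) λ i≰ → i≤ λ k e → i≰ (subst (i ≤_) e (m≤n+m i k)))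

-- The bound is written at depth d + 2, below the quantifier and the existential hidden in `≤̇`.
-- There the index of level l has grown by exactly two, because l < d keeps the subtraction from
-- truncating.
⌊ball⌋ : ∀ l {d} A → l < d → ⌊ ball l A ⌋ d ≡ all≤ (d ∸ suc l) (⌊ A ⌋ (suc d))
⌊ball⌋ l {d} A l<d = trans
  (cong₂ (λ i n → all (~ all (~ (var (d ∸ d) ⊕ var i ≐ var n)) ⇒ ⌊ A ⌋ (suc d)))
    (index-suc (≤-refl {suc d})) (trans (index-suc (m≤n⇒m≤1+n l<d)) (cong suc (index-suc l<d))))
  (cong (λ k → all (~ all (~ (var k ⊕ var (suc k) ≐ var (suc (suc (d ∸ suc l))))) ⇒ ⌊ A ⌋ (suc d)))
    (n∸n≡0 d))

Holds⇒⟦⟧ : ∀ F {d ρ} → Scoped d F → Holds F d ρ → ⟦ ⌊ F ⌋ d ⟧ ρ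
Holds⇒⟦⟧ (equ s t) _ h = trans (eval-emb s) (trans h (sym (eval-emb t)))
Holds⇒⟦⟧ (and A B) (p , q) (a , b) k = k (Holds⇒⟦⟧ A p a) (Holds⇒⟦⟧ B q b)
Holds⇒⟦⟧ (or A B) (p , q) (inj₁ a) k = ⊥-elim (k (Holds⇒⟦⟧ A p a))
Holds⇒⟦⟧ (or A B) (p , q) (inj₂ b) k = Holds⇒⟦⟧ B q b
Holds⇒⟦⟧ (ex A) p (n , a) k = k n (Holds⇒⟦⟧ A p a)
Holds⇒⟦⟧ (ball (suc l) A) {d} {ρ} (l<d , p) h = subst (λ B → ⟦ B ⟧ ρ) (sym (⌊ball⌋ (suc l) A (<ᵇ⇒< (suc l) d l<d)))
  (⟦all≤⟧⇐ _ (⌊ A ⌋ (suc d)) λ i i≤ → Holds⇒⟦⟧ A p (h i i≤))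

-- Over an unbounded range this would be double negation shift, which is not constructive; a finite
-- range admits induction.
¬¬-bounded : ∀ {P : ℕ → Set} n → (∀ i → i ≤ n → ¬ ¬ P i) → ¬ ¬ (∀ i → i ≤ n → P i)
¬¬-bounded zero    h k = h 0 z≤n λ p → k λ { .0 z≤n → p }
¬¬-bounded (suc n) h k = ¬¬-bounded n (λ i i≤ → h i (m≤n⇒m≤1+n i≤)) λ f → h (suc n) ≤-refl λ p →
  k λ i i≤ → [ (λ i< → f i (≤-pred i<)) , (λ { refl → p }) ]′ (m≤n⇒m<n∨m≡n i≤)

⟦⟧⇒Holds : ∀ F {d ρ} → Scoped d F → ⟦ ⌊ F ⌋ d ⟧ ρ → ¬ ¬ Holds F d ρ
⟦⟧⇒Holds (equ s t) _ h k = k (trans (sym (eval-emb s)) (trans h (eval-emb t)))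
⟦⟧⇒Holds bot _ h k = h
⟦⟧⇒Holds (and A B) (p , q) h k = h λ a b → ⟦⟧⇒Holds A p a λ a′ → ⟦⟧⇒Holds B q b λ b′ → k (a′ , b′)
⟦⟧⇒Holds (or A B) (p , q) h k =
  ⟦⟧⇒Holds B q (h λ a → ⟦⟧⇒Holds A p a (k ∘ inj₁)) (k ∘ inj₂)
⟦⟧⇒Holds (ex A) p h k = h λ n a → ⟦⟧⇒Holds A p a λ a′ → k (n , a′)
⟦⟧⇒Holds (ball (suc l) A) {d} {ρ} (l<d , p) h = ¬¬-bounded _ λ i i≤ → ⟦⟧⇒Holds A p
  (⟦all≤⟧⇒ _ (⌊ A ⌋ (suc d)) (subst (λ B → ⟦ B ⟧ ρ) (⌊ball⌋ (suc l) A (<ᵇ⇒< (suc l) d l<d)) h) i i≤)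

-- cut w F d is ⌊ F ⌋ d with all existential quantifiers bounded by level w.

cut : ℕ → Σ₁ → ℕ → Formula
cut w (equ s t) d   = emb s d ≐ emb t d
cut w bot d        = ⊥̇
cut w (and A B) d  = ~ (cut w A d ⇒ ~ cut w B d)
cut w (or A B) d   = ~ cut w A d ⇒ cut w B d
cut w (ex A) d     = ~ all≤ (d ∸ suc w) (~ cut w A (suc d))
cut w (ball l A) d = all≤ (d ∸ suc l) (cut w A (suc d))

cut-Δ₀ : ∀ w F d → Δ₀ (cut w F d)
cut-Δ₀ w (equ s t) d   = equation
cut-Δ₀ w bot d        = falsity
cut-Δ₀ w (and A B) d  = implies (implies (cut-Δ₀ w A d) (implies (cut-Δ₀ w B d) falsity)) falsity
cut-Δ₀ w (or A B) d   = implies (implies (cut-Δ₀ w A d) falsity) (cut-Δ₀ w B d)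
cut-Δ₀ w (ex A) d     = implies (bounded (implies (cut-Δ₀ w A (suc d)) falsity)) falsity
cut-Δ₀ w (ball l A) d = bounded (cut-Δ₀ w A (suc d))

cut-sound : ∀ w F {d ρ} → Scoped d F → ⟦ cut w F d ⟧ ρ → ¬ ¬ Holds F d ρ
cut-sound w (equ s t) _ h k = k (trans (sym (eval-emb s)) (trans h (eval-emb t)))
cut-sound w bot _ h k = h
cut-sound w (and A B) (p , q) h k = h λ a b → cut-sound w A p a λ a′ → cut-sound w B q b λ b′ → k (a′ , b′)
cut-sound w (or A B) (p , q) h k = cut-sound w B q (h λ a → cut-sound w A p a (k ∘ inj₁)) (k ∘ inj₂)
cut-sound w (ex A) {d} p h k = h (⟦all≤⟧⇐ (d ∸ suc w) (~ cut w A (suc d)) λ n _ a → cut-sound w A p a λ a′ → k (n , a′))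
cut-sound w (ball (suc l) A) {d} (_ , p) h = ¬¬-bounded _ λ i i≤ → cut-sound w A p (⟦all≤⟧⇒ _ (cut w A (suc d)) h i i≤)

AgreeExcept : ℕ → ℕ → Env → Env → Set
AgreeExcept w d ρ ρ′ = ∀ l → l < d → l ≢ w → ρ (d ∸ suc l) ≡ ρ′ (d ∸ suc l)

AgreeExcept-∷ : ∀ {w d ρ ρ′} n → AgreeExcept w d ρ ρ′ → AgreeExcept w (suc d) (n ∷ᵉ ρ) (n ∷ᵉ ρ′)
AgreeExcept-∷ {w} {d} {ρ} {ρ′} n e l l<1+d l≢w with m≤n⇒m<n∨m≡n l<1+d
... | inj₂ refl rewrite n∸n≡0 l = refl
... | inj₁ (s≤s l<d) rewrite index-suc l<d = e l l<d l≢w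

levelVal-agree : ∀ {w d ρ ρ′} → AgreeExcept w d ρ ρ′ → ∀ t → Scopedᵗ d t → Avoidsᵗ w t →
                 levelVal d ρ t ≡ levelVal d ρ′ t
levelVal-agree {w} {d} e (lv l) p q = e l (<ᵇ⇒< l d p) (≢-not-≡ᵇ l w q)
levelVal-agree e (lnum n) p q = refl
levelVal-agree e (lS t) p q = cong suc (levelVal-agree e t p q)
levelVal-agree e (lplus s t) (p , p′) (q , q′) = cong₂ _+_ (levelVal-agree e s p q) (levelVal-agree e t p′ q′)
levelVal-agree e (ltimes s t) (p , p′) (q , q′) = cong₂ _*_ (levelVal-agree e s p q) (levelVal-agree e t p′ q′)
levelVal-agree e (lpair s t) (p , p′) (q , q′) = cong₂ ⟪_,_⟫ (levelVal-agree e s p q) (levelVal-agree e t p′ q′)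

common-bound : ∀ {P : ℕ → ℕ → Set} → (∀ {i m m′} → m ≤ m′ → P i m → P i m′) →
               ∀ n → (∀ i → i ≤ n → ∃[ m ] P i m) → ∃[ m ] (∀ i → i ≤ n → P i m)
common-bound mono zero h with h 0 z≤n
... | m , p = m , λ { .0 z≤n → p }
common-bound mono (suc n) h with common-bound mono n (λ i i≤ → h i (m≤n⇒m≤1+n i≤)) | h (suc n) ≤-refl
... | m , f | m′ , p = m ⊔ m′ , λ i i≤ →
  [ (λ i< → mono (m≤m⊔n m m′) (f i (≤-pred i<))) , (λ { refl → mono (m≤n⊔m m m′) p }) ]′ (m≤n⇒m<n∨m≡n i≤)

-- The bound sits in the environment, so enlarging it means passing to another `ρ′`. Claiming truth
-- for every `ρ′` with at least m at level w lets the thresholds of subformulas be merged by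
-- maximum; `common-bound` merges the finitely many thresholds under a bounded quantifier.
cut-complete : ∀ w F {d ρ} → w < d → Scoped d F → Avoids w F → Holds F d ρ →
  ∃[ m ] (∀ ρ′ → AgreeExcept w d ρ ρ′ → m ≤ ρ′ (d ∸ suc w) → ⟦ cut w F d ⟧ ρ′)
cut-complete w (equ s t) w<d (p , p′) (q , q′) h = 0 , λ ρ′ e _ →
  trans (eval-emb s) (trans (sym (levelVal-agree e s p q)) (trans h
    (trans (levelVal-agree e t p′ q′) (sym (eval-emb t)))))
cut-complete w (and A B) w<d (p , p′) (q , q′) (a , b)
  with cut-complete w A w<d p q a | cut-complete w B w<d p′ q′ b
... | m , f | n , g = m ⊔ n , λ ρ′ e h k →
  k (f ρ′ e (≤-trans (m≤m⊔n m n) h)) (g ρ′ e (≤-trans (m≤n⊔m m n) h))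
cut-complete w (or A B) w<d (p , p′) (q , q′) (inj₁ a) with cut-complete w A w<d p q a
... | m , f = m , λ ρ′ e h k → ⊥-elim (k (f ρ′ e h))
cut-complete w (or A B) w<d (p , p′) (q , q′) (inj₂ b) with cut-complete w B w<d p′ q′ b
... | m , f = m , λ ρ′ e h k → f ρ′ e h
cut-complete w (ex A) {d} w<d p q (n , a) with cut-complete w A (m≤n⇒m≤1+n w<d) p q a
-- n makes room for the witness itself, m for the witnesses inside `A`.
... | m , f = m ⊔ n , λ ρ′ e h k → ⟦all≤⟧⇒ (d ∸ suc w) (~ cut w A (suc d)) k n (≤-trans (m≤n⊔m m n) h)
  (f (n ∷ᵉ ρ′) (AgreeExcept-∷ n e)
    (subst (λ i → m ≤ (n ∷ᵉ ρ′) i) (sym (index-suc w<d)) (≤-trans (m≤m⊔n m n) h)))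
cut-complete w (ball (suc l) A) {d} {ρ} w<d (l<d , p) (l≢w , q) h
  with common-bound
    {P = λ i m → ∀ ρ′ → AgreeExcept w (suc d) (i ∷ᵉ ρ) ρ′ → m ≤ ρ′ (suc d ∸ suc w) → ⟦ cut w A (suc d) ⟧ ρ′}
    (λ m≤m′ f ρ′ e h → f ρ′ e (≤-trans m≤m′ h))
    (ρ (d ∸ suc (suc l))) (λ i i≤ → cut-complete w A (m≤n⇒m≤1+n w<d) p q (h i i≤))
... | m , f = m , λ ρ′ e h → ⟦all≤⟧⇐ _ (cut w A (suc d)) λ i i≤ →
  f i (subst (i ≤_) (sym (e (suc l) (<ᵇ⇒< (suc l) d l<d) (≢-not-≡ᵇ _ w l≢w))) i≤)
    (i ∷ᵉ ρ′) (AgreeExcept-∷ i e) (subst (λ j → m ≤ (i ∷ᵉ ρ′) j) (sym (index-suc w<d)) h)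

-- Closedness

VarsBelowᵗ-numeral : ∀ d n → VarsBelowᵗ d (numeral n)
VarsBelowᵗ-numeral d zero    = tt
VarsBelowᵗ-numeral d (suc n) = VarsBelowᵗ-numeral d n

opaque
  unfolding ⟨_,_⟩

  VarsBelowᵗ-emb : ∀ t d → 0 < d → VarsBelowᵗ d (emb t d)
  VarsBelowᵗ-emb (lv l) d d>0       = index-< l d>0
  VarsBelowᵗ-emb (lnum n) d d>0     = VarsBelowᵗ-numeral d n
  VarsBelowᵗ-emb (lS t) d d>0    = VarsBelowᵗ-emb t d d>0
  VarsBelowᵗ-emb (lplus s t) d d>0  = VarsBelowᵗ-emb s d d>0 , VarsBelowᵗ-emb t d d>0
  VarsBelowᵗ-emb (ltimes s t) d d>0 = VarsBelowᵗ-emb s d d>0 , VarsBelowᵗ-emb t d d>0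
  VarsBelowᵗ-emb (lpair s t) d d>0  =
    let s′ = VarsBelowᵗ-emb s d d>0
        t′ = VarsBelowᵗ-emb t d d>0
    in ((s′ , t′) , (s′ , t′)) , s′

VarsBelow-all≤ : ∀ {j d} A → j < d → VarsBelow (suc d) A → VarsBelow d (all≤ j A)
VarsBelow-all≤ A j<d h = ((((s≤s z≤n , s≤s (s≤s z≤n)) , s≤s (s≤s j<d)) , tt) , tt) , h

VarsBelow-cut : ∀ w F d → 0 < d → VarsBelow d (cut w F d)
VarsBelow-cut w (equ s t) d d>0   = VarsBelowᵗ-emb s d d>0 , VarsBelowᵗ-emb t d d>0
VarsBelow-cut w bot d d>0        = tt
VarsBelow-cut w (and A B) d d>0  = (VarsBelow-cut w A d d>0 , VarsBelow-cut w B d d>0 , tt) , tt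
VarsBelow-cut w (or A B) d d>0   = (VarsBelow-cut w A d d>0 , tt) , VarsBelow-cut w B d d>0
VarsBelow-cut w (ex A) d d>0     =
  VarsBelow-all≤ (~ cut w A (suc d)) (index-< w d>0) (VarsBelow-cut w A (suc d) (s≤s z≤n) , tt) , tt
VarsBelow-cut w (ball l A) d d>0 = VarsBelow-all≤ (cut w A (suc d)) (index-< l d>0) (VarsBelow-cut w A (suc d) (s≤s z≤n))

VarsBelowᵗ-subst : ∀ {m n f} t → (∀ i → i < m → VarsBelowᵗ n (f i)) → VarsBelowᵗ m t → VarsBelowᵗ n (substVars f t)
VarsBelowᵗ-subst (var i) h p       = h i p
VarsBelowᵗ-subst 𝟎       h p       = tt
VarsBelowᵗ-subst (S t)   h p       = VarsBelowᵗ-subst t h p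
VarsBelowᵗ-subst (t ⊕ u) h (p , q) = VarsBelowᵗ-subst t h p , VarsBelowᵗ-subst u h q
VarsBelowᵗ-subst (t ⊗ u) h (p , q) = VarsBelowᵗ-subst t h p , VarsBelowᵗ-subst u h q

VarsBelow-subst : ∀ {m n f} A → (∀ i → i < m → VarsBelowᵗ n (f i)) → VarsBelow m A → VarsBelow n (A ∙ f)
VarsBelow-subst (t ≐ u) h (p , q) = VarsBelowᵗ-subst t h p , VarsBelowᵗ-subst u h q
VarsBelow-subst ⊥̇       h p       = tt
VarsBelow-subst (A ⇒ B) h (p , q) = VarsBelow-subst A h p , VarsBelow-subst B h q
VarsBelow-subst {m} {n} {f} (all A) h p = VarsBelow-subst A h′ p
  where
  h′ : ∀ i → i < suc m → VarsBelowᵗ (suc n) (exts f i)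
  h′ zero    _         = s≤s z≤n
  h′ (suc i) (s≤s i<m) = VarsBelowᵗ-subst (f i) (λ j → s≤s) (h i i<m)

-- Parameters: substituting a numeral for level 0

setParamᵗ : ℕ → LTm → LTm
setParamᵗ g (lv zero)    = lnum g
setParamᵗ g (lv (suc l)) = lv l
setParamᵗ g (lnum n)     = lnum n
setParamᵗ g (lS t)    = lS (setParamᵗ g t)
setParamᵗ g (lplus s t)  = lplus (setParamᵗ g s) (setParamᵗ g t)
setParamᵗ g (ltimes s t) = ltimes (setParamᵗ g s) (setParamᵗ g t)
setParamᵗ g (lpair s t)  = lpair (setParamᵗ g s) (setParamᵗ g t)

setParam : ℕ → Σ₁ → Σ₁
setParam g (equ s t)         = equ (setParamᵗ g s) (setParamᵗ g t)
setParam g bot              = bot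
setParam g (and A B)        = and (setParam g A) (setParam g B)
setParam g (or A B)         = or (setParam g A) (setParam g B)
setParam g (ex A)           = ex (setParam g A)
-- A numeral cannot bound a quantifier of `Σ₁`; `Scoped` excludes this case.
setParam g (ball zero A)    = bot
setParam g (ball (suc l) A) = ball l (setParam g A)

-- At depth d + 1 the parameter, level 0, has index d; replacing it means pushing `inst` under d
-- binders.
liftⁿ : ℕ → Subst → Subst
liftⁿ zero    σ = σ
liftⁿ (suc d) σ = lift (liftⁿ d σ)

liftⁿ-at-< : ∀ d σ {i} → i < d → liftⁿ d σ at i ≡ var i
liftⁿ-at-< (suc d) σ {zero}  _         = refl
liftⁿ-at-< (suc d) σ {suc i} (s≤s i<d) = cong raise (liftⁿ-at-< d σ i<d)

liftⁿ-at : ∀ d g → liftⁿ d (inst (numeral g)) at d ≡ numeral g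
liftⁿ-at zero    g = refl
liftⁿ-at (suc d) g = trans (cong raise (liftⁿ-at d g)) (substVars-numeral _ g)

opaque
  unfolding ⟨_,_⟩

  setParamᵗ-[] : ∀ g t d → 0 < d → emb t (suc d) [ liftⁿ d (inst (numeral g)) ]ᵗ ≡ emb (setParamᵗ g t) d
  setParamᵗ-[] g (lv zero) d d>0    = liftⁿ-at d g
  setParamᵗ-[] g (lv (suc l)) d d>0 = liftⁿ-at-< d _ (index-< l d>0)
  setParamᵗ-[] g (lnum n) d d>0     = substVars-numeral _ n
  setParamᵗ-[] g (lS t) d d>0    = cong S_ (setParamᵗ-[] g t d d>0)
  setParamᵗ-[] g (lplus s t) d d>0  = cong₂ _⊕_ (setParamᵗ-[] g s d d>0) (setParamᵗ-[] g t d d>0)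
  setParamᵗ-[] g (ltimes s t) d d>0 = cong₂ _⊗_ (setParamᵗ-[] g s d d>0) (setParamᵗ-[] g t d d>0)
  setParamᵗ-[] g (lpair s t) d d>0  =
    cong₂ (λ a b → (a ⊕ b) ⊗ (a ⊕ b) ⊕ a) (setParamᵗ-[] g s d d>0) (setParamᵗ-[] g t d d>0)

setParam-[] : ∀ g F d → 0 < d → Scoped (suc d) F →
              ⌊ F ⌋ (suc d) [ liftⁿ d (inst (numeral g)) ] ≡ ⌊ setParam g F ⌋ d
setParam-[] g (equ s t) d d>0 _ = cong₂ _≐_ (setParamᵗ-[] g s d d>0) (setParamᵗ-[] g t d d>0)
setParam-[] g bot d d>0 _ = refl
setParam-[] g (and A B) d d>0 (p , q) =
  cong₂ (λ A B → ~ (A ⇒ ~ B)) (setParam-[] g A d d>0 p) (setParam-[] g B d d>0 q)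
setParam-[] g (or A B) d d>0 (p , q) =
  cong₂ (λ A B → ~ A ⇒ B) (setParam-[] g A d d>0 p) (setParam-[] g B d d>0 q)
setParam-[] g (ex A) d d>0 p = cong (λ A → ~ all (~ A)) (setParam-[] g A (suc d) (s≤s z≤n) p)
setParam-[] g (ball (suc l) A) d d>0 (l<d , p) = trans
  (cong _[ liftⁿ d (inst (numeral g)) ] (⌊ball⌋ (suc l) A (<ᵇ⇒< (suc l) (suc d) l<d)))
  (trans (cong₂ (λ t A → all (~ all (~ (var 0 ⊕ var 1 ≐ raise (raise t))) ⇒ A))
           (liftⁿ-at-< d (inst (numeral g)) (index-< l {d} d>0)) (setParam-[] g A (suc d) (s≤s z≤n) p))
         (sym (⌊ball⌋ l (setParam g A) (≤-pred (<ᵇ⇒< (suc l) (suc d) l<d)))))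

-- Injectivity of the pairing

opaque
  unfolding ⟪_,_⟫

  -- Pairs of sum s take values from s² to s² + s, which stays below (s + 1)².
  square-gap : ∀ {m n m′ n′} → m + n < m′ + n′ → ⟪ m , n ⟫ < ⟪ m′ , n′ ⟫
  square-gap {m} {n} {m′} {n′} h = begin-strict
    (m + n) * (m + n) + m         ≤⟨ +-monoʳ-≤ ((m + n) * (m + n)) (m≤m+n m n) ⟩
    (m + n) * (m + n) + (m + n)   ≡⟨ +-comm ((m + n) * (m + n)) (m + n) ⟩
    suc (m + n) * (m + n)         <⟨ *-monoʳ-< (suc (m + n)) (n<1+n (m + n)) ⟩
    suc (m + n) * suc (m + n)     ≤⟨ *-mono-≤ h h ⟩
    (m′ + n′) * (m′ + n′)         ≤⟨ m≤m+n _ m′ ⟩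
    (m′ + n′) * (m′ + n′) + m′    ∎
    where open ≤-Reasoning

  pair-injective : ∀ {m n m′ n′} → ⟪ m , n ⟫ ≡ ⟪ m′ , n′ ⟫ → m ≡ m′ × n ≡ n′
  pair-injective {m} {n} {m′} {n′} e with <-cmp (m + n) (m′ + n′)
  ... | tri< h _ _ = ⊥-elim (<-irrefl e (square-gap {m} {n} {m′} {n′} h))
  ... | tri> _ _ h = ⊥-elim (<-irrefl (sym e) (square-gap {m′} {n′} {m} {n} h))
  ... | tri≈ _ h _ = m≡m′ , +-cancelˡ-≡ m n n′ (trans h (cong (_+ n′) (sym m≡m′)))
    where
    m≡m′ : m ≡ m′
    m≡m′ = +-cancelˡ-≡ ((m + n) * (m + n)) m m′ (trans e (cong (λ k → k * k + m′) (sym h)))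

-- Gödel's β-function

coprime-* : ∀ {m n o} → Coprime m o → Coprime n o → Coprime (m * n) o
coprime-* {m} m⊥o n⊥o (d∣mn , d∣o) =
  n⊥o (coprime-divisor {n = m} (λ (e∣d , e∣m) → m⊥o (e∣m , ∣-trans e∣d d∣o)) d∣mn , d∣o)

-- Bézout yields an inverse of M or of -M modulo e + 1. To stay within ℕ, -1 is written as e, and a
-- multiple `p` of the modulus is added on the left.
crt-step : ∀ a M e y → Coprime M (suc e) → y < suc e → ∃[ v ] ∃[ q ] a + M * v ≡ q * suc e + y
crt-step a M e y co y< = v , (a + M * v) / suc e , trans (m≡m%n+[m/n]*n (a + M * v) (suc e))
  (trans (+-comm ((a + M * v) % suc e) ((a + M * v) / suc e * suc e)) (cong ((a + M * v) / suc e * suc e +_) rem))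
  where
  open +-*-Solver
  solution : ∃[ v ] ∃[ p ] ∃[ q ] a + M * v + p * suc e ≡ y + q * suc e
  solution with coprime-Bézout co
  -- x inverts M, and y + a e is congruent to y - a.
  ... | Bézout.+- x z eq = x * (y + a * e) , 0 , a + z * (y + a * e) , (begin
    a + M * (x * (y + a * e)) + 0
      ≡⟨ solve 5 (λ a M e y x → a :+ M :* (x :* (y :+ a :* e)) :+ con 0 :=
                 a :+ x :* M :* (y :+ a :* e)) refl a M e y x ⟩
    a + x * M * (y + a * e)             ≡⟨ cong (λ t → a + t * (y + a * e)) (sym eq) ⟩
    a + (1 + z * suc e) * (y + a * e)
      ≡⟨ solve 4 (λ a e y z → a :+ (con 1 :+ z :* (con 1 :+ e)) :* (y :+ a :* e) :=
                 y :+ (a :+ z :* (y :+ a :* e)) :* (con 1 :+ e)) refl a e y z ⟩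
    y + (a + z * (y + a * e)) * suc e   ∎)
    where open ≡-Reasoning
  -- x inverts -M, and a + y e is congruent to a - y.
  ... | Bézout.-+ x z eq = x * (a + y * e) , y , z * (a + y * e) , +-cancelˡ-≡ a _ _ (begin
    a + (a + M * (x * (a + y * e)) + y * suc e)
      ≡⟨ solve 5 (λ a M e y x → a :+ (a :+ M :* (x :* (a :+ y :* e)) :+ y :* (con 1 :+ e)) :=
                 a :+ (y :+ (con 1 :+ x :* M) :* (a :+ y :* e))) refl a M e y x ⟩
    a + (y + (1 + x * M) * (a + y * e))          ≡⟨ cong (λ t → a + (y + t * (a + y * e))) eq ⟩
    a + (y + z * suc e * (a + y * e))
      ≡⟨ solve 4 (λ a e y z → a :+ (y :+ z :* (con 1 :+ e) :* (a :+ y :* e)) :=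
                 a :+ (y :+ z :* (a :+ y :* e) :* (con 1 :+ e))) refl a e y z ⟩
    a + (y + z * (a + y * e) * suc e)            ∎)
    where open ≡-Reasoning
  v = proj₁ solution
  p = proj₁ (proj₂ solution)
  q = proj₁ (proj₂ (proj₂ solution))
  rem : (a + M * v) % suc e ≡ y
  rem = begin
    (a + M * v) % suc e               ≡⟨ [m+kn]%n≡m%n (a + M * v) p (suc e) ⟨
    (a + M * v + p * suc e) % suc e   ≡⟨ cong (_% suc e) (proj₂ (proj₂ (proj₂ solution))) ⟩
    (y + q * suc e) % suc e           ≡⟨ [m+kn]%n≡m%n y q (suc e) ⟩
    y % suc e                         ≡⟨ m<n⇒m%n≡m y< ⟩
    y                                 ∎
    where open ≡-Reasoning

product< : (ℕ → ℕ) → ℕ → ℕ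
product< m zero    = 1
product< m (suc n) = product< m n * m n

∣-product< : ∀ m {i n} → i < n → m i ∣ product< m n
∣-product< m {i} {suc n} i<1+n with m≤n⇒m<n∨m≡n (≤-pred i<1+n)
... | inj₁ i<n  = ∣m⇒∣m*n (m n) (∣-product< m i<n)
... | inj₂ refl = ∣n⇒∣m*n (product< m i) ∣-refl

coprime-product< : ∀ m n {o} → (∀ i → i < n → Coprime (m i) o) → Coprime (product< m n) o
coprime-product< m zero    h (d∣1 , _) = ∣1⇒≡1 d∣1
coprime-product< m (suc n) h = coprime-* (coprime-product< m n (λ i i<n → h i (m<n⇒m<1+n i<n))) (h n ≤-refl)

-- Adding a multiple of the product of the earlier moduli keeps their remainders, and coprimality
-- lets the multiple be chosen to give the next remainder.
chinese-remainder : ∀ (e f : ℕ → ℕ) n → (∀ i j → i < j → j < n → Coprime (suc (e i)) (suc (e j))) →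
  (∀ i → i < n → f i < suc (e i)) → ∃[ a ] (∀ i → i < n → ∃[ q ] a ≡ q * suc (e i) + f i)
chinese-remainder e f zero co small = 0 , λ _ ()
chinese-remainder e f (suc n) co small
  with chinese-remainder e f n (λ i j i<j j<n → co i j i<j (m<n⇒m<1+n j<n)) (λ i i<n → small i (m<n⇒m<1+n i<n))
... | a , sol with crt-step a (product< (suc ∘ e) n) (e n) (f n)
                     (coprime-product< (suc ∘ e) n λ i i<n → co i n i<n ≤-refl) (small n ≤-refl)
... | v , q , eq = a + product< (suc ∘ e) n * v , sol′
  where
  open +-*-Solver
  sol′ : ∀ i → i < suc n → ∃[ q ] a + product< (suc ∘ e) n * v ≡ q * suc (e i) + f i
  sol′ i i<1+n with m≤n⇒m<n∨m≡n (≤-pred i<1+n)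
  ... | inj₂ refl = q , eq
  ... | inj₁ i<n with sol i i<n | ∣-product< (suc ∘ e) i<n
  ...   | qi , a≡ | divides r M≡ = qi + r * v , trans (cong₂ (λ s t → s + t * v) a≡ M≡)
    (solve 5 (λ q m y r v → q :* m :+ y :+ r :* m :* v :=
      (q :+ r :* v) :* m :+ y) refl qi (suc (e i)) (f i) r v)

∣! : ∀ {k n} → 0 < k → k ≤ n → k ∣ n !
∣! {suc k} _ k≤n = ∣-trans (m∣m*n (k !)) (m≤n⇒m!∣n! k≤n)

-- A common divisor d is coprime to b, as it divides 1 + (i + 1) b. It divides the difference b (j -
-- i) of the two moduli, hence j - i, hence b by assumption; so d = 1.
β-coprime : ∀ {b n} → (∀ k → 0 < k → k ≤ n → k ∣ b) → ∀ i j → i < j → j < n →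
            Coprime (suc (suc i * b)) (suc (suc j * b))
β-coprime {b} {n} div i j i<j j<n {d} (d∣mi , d∣mj) = d⊥b (∣-refl , ∣-trans d∣j∸i (div (j ∸ i) (m<n⇒0<n∸m i<j) (≤-trans (m∸n≤m j i) (<⇒≤ j<n))))
  where
  open +-*-Solver
  d⊥b : Coprime d b
  d⊥b {e} (e∣d , e∣b) = ∣1⇒≡1 (∣m+n∣m⇒∣n (subst (e ∣_) (+-comm 1 (suc i * b)) (∣-trans e∣d d∣mi)) (∣n⇒∣m*n (suc i) e∣b))
  difference : suc (suc j * b) ≡ suc (suc i * b) + b * (j ∸ i)
  difference = trans (cong (λ k → suc (suc k * b)) (sym (m∸n+n≡m (<⇒≤ i<j))))
    (solve 3 (λ k i b → con 1 :+ (con 1 :+ (k :+ i)) :* b :=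
      con 1 :+ (con 1 :+ i) :* b :+ b :* k) refl (j ∸ i) i b)
  d∣j∸i : d ∣ j ∸ i
  d∣j∸i = coprime-divisor d⊥b (∣m+n∣m⇒∣n (subst (d ∣_) difference d∣mj) d∣mi)

β-function : ∀ n (f : ℕ → ℕ) → ∃[ s ] (∀ i → i < n → Val.Entry s i (f i))
β-function n f = ⟪ proj₁ remainders , b ⟫ , λ i i<n →
  proj₁ remainders , b , proj₁ (proj₂ remainders i i<n) , refl , proj₂ (proj₂ remainders i i<n) ,
  suc (suc i * b) ∸ suc (f i) , m∸n+n≡m (small i i<n)
  where
  maximum : ∃[ m ] (∀ i → i ≤ n → f i ≤ m)
  maximum = common-bound (λ m≤m′ h → ≤-trans h m≤m′) n (λ i _ → f i , ≤-refl)
  -- The factorial gives the divisibility from which the moduli are coprime; the maximum makes each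
  -- modulus exceed its entry.
  b : ℕ
  b = n ! * proj₁ maximum
  small : ∀ i → i < n → f i < suc (suc i * b)
  small i i<n = s≤s (≤-trans (proj₂ maximum i (<⇒≤ i<n))
    (≤-trans (m≤n*m (proj₁ maximum) (n !) {{n !≢0}}) (m≤m+n b (i * b))))
  remainders : ∃[ a ] (∀ i → i < n → ∃[ q ] a ≡ q * suc (suc i * b) + f i)
  remainders = chinese-remainder (λ i → suc i * b) f n
    (β-coprime λ k k>0 k≤n → ∣m⇒∣m*n (proj₁ maximum) (∣! k>0 k≤n)) small

-- Generated sets: induction, and construction of derivations

<̇⇒< : ∀ {i j} → i Val.<̇ j → i < j
<̇⇒< {i} (k , e) = subst (suc i ≤_) e (m≤n+m (suc i) k)

<⇒<̇ : ∀ {i j} → i < j → i Val.<̇ j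
<⇒<̇ {i} {j} i<j = j ∸ suc i , m∸n+n≡m i<j

entry-unique : ∀ {s i y y′} → Val.Entry s i y → Val.Entry s i y′ → y ≡ y′
entry-unique {i = i} {y} {y′} (a , b , q , refl , a≡ , y<) (a′ , b′ , q′ , e , a′≡ , y′<)
  with pair-injective e
... | refl , refl = trans (sym (remainder q a≡ y<)) (remainder q′ a′≡ y′<)
  where
  m : ℕ
  m = suc (suc i * b)
  remainder : ∀ {y} q → a ≡ q * m + y → y Val.<̇ m → a % m ≡ y
  remainder {y} q a≡ y< = trans (cong (_% m) (trans a≡ (+-comm (q * m) y)))
    (trans ([m+kn]%n≡m%n y q m) (m<n⇒m%n≡m (<̇⇒< y<)))

-- Well-founded induction on positions. `closed` quantifies over the predicate `E`, so it applies to
-- being an entry before i; `entry-unique` identifies the entry certified by the derivation with the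
-- given one.
generated-elim : ∀ {R : Val.Rule} {Q : ℕ → Set} →
  (∀ {E y} → (∀ {w} → E w → Q w) → R E y → Q y) → ∀ {y} → Val.Generated R y → Q y
generated-elim {R} {Q} closed {y} (s , n , entry , derived) =
  <-rec (λ i → i ≤ n → ∀ {y} → Val.Entry s i y → Q y) induct n ≤-refl entry
  where
  induct : ∀ i → (∀ {j} → j < i → j ≤ n → ∀ {y} → Val.Entry s j y → Q y) →
           i ≤ n → ∀ {y} → Val.Entry s i y → Q y
  induct i earlier i≤n {y} e with derived i i≤n
  ... | z , e′ , r = subst Q (entry-unique {s} {i} e′ e)
    (closed (λ (j , j<i , ej) → earlier (<̇⇒< j<i) (≤-trans (<⇒≤ (<̇⇒< j<i)) i≤n) ej) r)

Monotone : Val.Rule → Set₁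
Monotone R = ∀ {E E′ y} → (∀ {w} → E w → E′ w) → R E y → R E′ y

-- A derivation as a list, latest entry first.

Derived : Val.Rule → List ℕ → Set
Derived R []       = ⊤
Derived R (y ∷ ys) = R (_∈ ys) y × Derived R ys

-- Positions count from the oldest entry, so they survive when a new entry is put in front. The 0 is
-- a junk value past the end.
nth : List ℕ → ℕ → ℕ
nth []       i = 0
nth (y ∷ ys) i with i ≟ length ys
... | yes _ = y
... | no  _ = nth ys i

nth-length : ∀ y ys → nth (y ∷ ys) (length ys) ≡ y
nth-length y ys with length ys ≟ length ys
... | yes _ = refl
... | no ¬e = ⊥-elim (¬e refl)

nth-< : ∀ y ys {i} → i < length ys → nth (y ∷ ys) i ≡ nth ys i
nth-< y ys {i} h with i ≟ length ys
... | yes e = ⊥-elim (<-irrefl e h)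
... | no _  = refl

∈⇒nth : ∀ {y ys} → y ∈ ys → ∃[ i ] i < length ys × nth ys i ≡ y
∈⇒nth {ys = y ∷ ys} (here refl) = length ys , ≤-refl , nth-length y ys
∈⇒nth {ys = y ∷ ys} (there p) with ∈⇒nth p
... | i , i< , e = i , m<n⇒m<1+n i< , trans (nth-< y ys i<) e

module _ {R : Val.Rule} (mono : Monotone R) where

  Derived-nth : ∀ ys → Derived R ys → ∀ i → i < length ys →
                R (λ w → ∃[ j ] j < i × nth ys j ≡ w) (nth ys i)
  Derived-nth (y ∷ ys) (r , d) i i< with m≤n⇒m<n∨m≡n (≤-pred i<)
  ... | inj₁ i<′ = subst (R _) (sym (nth-< y ys i<′))
    (mono (λ (j , j<i , e) → j , j<i , trans (nth-< y ys (<-trans j<i i<′)) e) (Derived-nth ys d i i<′))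
  ... | inj₂ refl = subst (R _) (sym (nth-length y ys))
    (mono (λ p → let (j , j< , e) = ∈⇒nth p in j , j< , trans (nth-< y ys j<) e) r)

  Derived-++ : ∀ xs {ys} → Derived R xs → Derived R ys → Derived R (xs ++ ys)
  Derived-++ []       d       d′ = d′
  Derived-++ (x ∷ xs) (r , d) d′ = mono ∈-++⁺ˡ r , Derived-++ xs d d′

  -- The β-function codes the list, and the derivation stops at the position of y, which may lie
  -- anywhere in it.
  Derived⇒Generated : ∀ {y} ys → Derived R ys → y ∈ ys → Val.Generated R y
  Derived⇒Generated {y} ys d y∈ with ∈⇒nth y∈ | β-function (length ys) (nth ys)
  ... | n , n< , e | s , entry = s , n , subst (Val.Entry s n) e (entry n n<) , λ i i≤n →
    nth ys i , entry i (≤-<-trans i≤n n<) ,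
    mono (λ (j , j<i , e′) → j , <⇒<̇ j<i , subst (Val.Entry s j) e′ (entry j (<-trans j<i (≤-<-trans i≤n n<))))
         (Derived-nth ys d i (≤-<-trans i≤n n<))

Derivable : Val.Rule → ℕ → Set
Derivable R y = ∃[ ys ] Derived R ys × y ∈ ys

derive₂ : ∀ {R y u v} → Monotone R → Derivable R u → Derivable R v →
          (∀ {E} → E u → E v → R E y) → Derivable R y
derive₂ mono (us , du , u∈) (vs , dv , v∈) r =
  _ , (r (∈-++⁺ˡ u∈) (∈-++⁺ʳ us v∈) , Derived-++ mono us du dv) , here refl

derive₁ : ∀ {R y u} → Derivable R u → (∀ {E} → E u → R E y) → Derivable R y
derive₁ (us , du , u∈) r = _ , (r u∈ , du) , here refl

derive₀ : ∀ {R y} → (∀ {E} → R E y) → Derivable R y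
derive₀ r = _ , (r {_∈ []} , tt) , here refl

open Val using (cvar; czero; cS; cplus; ctimes; ceq; cbot; cimp; call; cshift; cstep; cinst; clift)

⌜_⌝ᵗ : Term → ℕ
⌜_⌝ᵗ = Defs.Coding.codeᵗ id ⟪_,_⟫

⌜_⌝ˢ : Subst → ℕ
⌜ shift ⌝ˢ  = cshift
⌜ inst t ⌝ˢ = cinst ⌜ t ⌝ᵗ
⌜ step ⌝ˢ   = cstep
⌜ lift σ ⌝ˢ = clift ⌜ σ ⌝ˢ

-- Adequacy of the arithmetized syntax

tag-≡ : ∀ {k m l n} → ⟪ k , m ⟫ ≡ ⟪ l , n ⟫ → k ≡ l
tag-≡ e = proj₁ (pair-injective e)

body-≡ : ∀ {k m l n} → ⟪ k , m ⟫ ≡ ⟪ l , n ⟫ → m ≡ n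
body-≡ e = proj₂ (pair-injective e)

codeᵗ-injective : ∀ t u → ⌜ t ⌝ᵗ ≡ ⌜ u ⌝ᵗ → t ≡ u
codeᵗ-injective₂ : ∀ {k} t t′ u u′ → ⟪ k , ⟪ ⌜ t ⌝ᵗ , ⌜ t′ ⌝ᵗ ⟫ ⟫ ≡ ⟪ k , ⟪ ⌜ u ⌝ᵗ , ⌜ u′ ⌝ᵗ ⟫ ⟫ → t ≡ u × t′ ≡ u′
codeᵗ-injective₂ t t′ u u′ e =
  codeᵗ-injective t u (tag-≡ (body-≡ e)) , codeᵗ-injective t′ u′ (body-≡ (body-≡ e))
codeᵗ-injective (var i) (var j) e = cong var (body-≡ e)
codeᵗ-injective 𝟎       𝟎       e = refl
codeᵗ-injective (S t)   (S u)   e = cong S_ (codeᵗ-injective t u (body-≡ e))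
codeᵗ-injective (t ⊕ t′) (u ⊕ u′) e = let (p , q) = codeᵗ-injective₂ t t′ u u′ e in cong₂ _⊕_ p q
codeᵗ-injective (t ⊗ t′) (u ⊗ u′) e = let (p , q) = codeᵗ-injective₂ t t′ u u′ e in cong₂ _⊗_ p q
codeᵗ-injective (var _) 𝟎       e with () ← tag-≡ e
codeᵗ-injective (var _) (S _)   e with () ← tag-≡ e
codeᵗ-injective (var _) (_ ⊕ _) e with () ← tag-≡ e
codeᵗ-injective (var _) (_ ⊗ _) e with () ← tag-≡ e
codeᵗ-injective 𝟎       (var _) e with () ← tag-≡ e
codeᵗ-injective 𝟎       (S _)   e with () ← tag-≡ e
codeᵗ-injective 𝟎       (_ ⊕ _) e with () ← tag-≡ e
codeᵗ-injective 𝟎       (_ ⊗ _) e with () ← tag-≡ e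
codeᵗ-injective (S _)   (var _) e with () ← tag-≡ e
codeᵗ-injective (S _)   𝟎       e with () ← tag-≡ e
codeᵗ-injective (S _)   (_ ⊕ _) e with () ← tag-≡ e
codeᵗ-injective (S _)   (_ ⊗ _) e with () ← tag-≡ e
codeᵗ-injective (_ ⊕ _) (var _) e with () ← tag-≡ e
codeᵗ-injective (_ ⊕ _) 𝟎       e with () ← tag-≡ e
codeᵗ-injective (_ ⊕ _) (S _)   e with () ← tag-≡ e
codeᵗ-injective (_ ⊕ _) (_ ⊗ _) e with () ← tag-≡ e
codeᵗ-injective (_ ⊗ _) (var _) e with () ← tag-≡ e
codeᵗ-injective (_ ⊗ _) 𝟎       e with () ← tag-≡ e
codeᵗ-injective (_ ⊗ _) (S _)   e with () ← tag-≡ e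
codeᵗ-injective (_ ⊗ _) (_ ⊕ _) e with () ← tag-≡ e

code-injective : ∀ A B → ⌜ A ⌝ ≡ ⌜ B ⌝ → A ≡ B
code-injective (t ≐ t′) (u ≐ u′) e = let (p , q) = codeᵗ-injective₂ t t′ u u′ e in cong₂ _≐_ p q
code-injective ⊥̇       ⊥̇       e = refl
code-injective (A ⇒ A′) (B ⇒ B′) e =
  cong₂ _⇒_ (code-injective A B (tag-≡ (body-≡ e))) (code-injective A′ B′ (body-≡ (body-≡ e)))
code-injective (all A) (all B) e = cong all (code-injective A B (body-≡ e))
code-injective (_ ≐ _) ⊥̇       e with () ← tag-≡ e
code-injective (_ ≐ _) (_ ⇒ _) e with () ← tag-≡ e
code-injective (_ ≐ _) (all _) e with () ← tag-≡ e
code-injective ⊥̇       (_ ≐ _) e with () ← tag-≡ e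
code-injective ⊥̇       (_ ⇒ _) e with () ← tag-≡ e
code-injective ⊥̇       (all _) e with () ← tag-≡ e
code-injective (_ ⇒ _) (_ ≐ _) e with () ← tag-≡ e
code-injective (_ ⇒ _) ⊥̇       e with () ← tag-≡ e
code-injective (_ ⇒ _) (all _) e with () ← tag-≡ e
code-injective (all _) (_ ≐ _) e with () ← tag-≡ e
code-injective (all _) ⊥̇       e with () ← tag-≡ e
code-injective (all _) (_ ⇒ _) e with () ← tag-≡ e

-- Modus ponens in `proofRule` does not say that its conclusion is a formula; this is read off from
-- the code of the proved implication.
cimp-inversion : ∀ A {y} C → cimp ⌜ A ⌝ y ≡ ⌜ C ⌝ → ∃[ B ] C ≡ A ⇒ B × y ≡ ⌜ B ⌝
cimp-inversion A (A′ ⇒ B) e with code-injective A A′ (tag-≡ (body-≡ e))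
... | refl = B , refl , body-≡ (body-≡ e)
cimp-inversion A (_ ≐ _) e with () ← tag-≡ e
cimp-inversion A ⊥̇       e with () ← tag-≡ e
cimp-inversion A (all _) e with () ← tag-≡ e

pattern clause₀ x  = inj₁ x
pattern clause₁ x  = inj₂ (clause₀ x)
pattern clause₂ x  = inj₂ (clause₁ x)
pattern clause₃ x  = inj₂ (clause₂ x)
pattern clause₄ x  = inj₂ (clause₃ x)
pattern clause₅ x  = inj₂ (clause₄ x)
pattern clause₆ x  = inj₂ (clause₅ x)
pattern clause₇ x  = inj₂ (clause₆ x)
pattern clause₈ x  = inj₂ (clause₇ x)
pattern clause₉ x  = inj₂ (clause₈ x)
pattern clause₁₀ x = inj₂ (clause₉ x)
pattern clause₁₁ x = inj₂ (clause₁₀ x)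
pattern clause₁₂ x = inj₂ (clause₁₁ x)
pattern clause₁₃ x = inj₂ (clause₁₂ x)
pattern clause₁₄ x = inj₂ (clause₁₃ x)

numeral-mono : Monotone Val.numeralRule
numeral-mono h (clause₀ e) = clause₀ e
numeral-mono h (clause₁ (n , u , p , e)) = clause₁ (n , u , h p , e)

numeralCode-complete : ∀ n → Val.NumeralCode n ⌜ numeral n ⌝ᵗ
numeralCode-complete n = let (_ , d , y∈) = derivable n in Derived⇒Generated numeral-mono _ d y∈
  where
  derivable : ∀ n → Derivable Val.numeralRule ⟪ n , ⌜ numeral n ⌝ᵗ ⟫
  derivable zero    = derive₀ (clause₀ refl)
  derivable (suc n) = derive₁ (derivable n) λ p → clause₁ (n , ⌜ numeral n ⌝ᵗ , p , refl)

numeralCode-sound : ∀ {n u} → Val.NumeralCode n u → u ≡ ⌜ numeral n ⌝ᵗ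
numeralCode-sound {n} {u} g with generated-elim {R = Val.numeralRule} {Q} closed g
  where
  Q : ℕ → Set
  Q y = ∃[ n ] y ≡ ⟪ n , ⌜ numeral n ⌝ᵗ ⟫
  closed : ∀ {E y} → (∀ {w} → E w → Q w) → Val.numeralRule E y → Q y
  closed ih (clause₀ e) = 0 , e
  closed ih (clause₁ (n , u , p , e)) with ih p
  ... | m , e′ with pair-injective e′
  ... | refl , refl = suc m , e
... | m , e with pair-injective e
... | refl , u≡ = u≡

formation-mono : Monotone Val.formationRule
formation-mono h (clause₀ c) = clause₀ c
formation-mono h (clause₁ c) = clause₁ c
formation-mono h (clause₂ (t , p , e)) = clause₂ (t , h p , e)
formation-mono h (clause₃ (t , u , p , q , e)) = clause₃ (t , u , h p , h q , e)
formation-mono h (clause₄ (t , u , p , q , e)) = clause₄ (t , u , h p , h q , e)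
formation-mono h (clause₅ (t , u , p , q , e)) = clause₅ (t , u , h p , h q , e)
formation-mono h (clause₆ c) = clause₆ c
formation-mono h (clause₇ (a , b , p , q , e)) = clause₇ (a , b , h p , h q , e)
formation-mono h (clause₈ (a , p , e)) = clause₈ (a , h p , e)

term-derivable : ∀ t → Derivable Val.formationRule (Val.term ⌜ t ⌝ᵗ)
term-derivable (var i) = derive₀ (clause₀ (i , refl))
term-derivable 𝟎       = derive₀ (clause₁ refl)
term-derivable (S t)   = derive₁ (term-derivable t) λ p → clause₂ (⌜ t ⌝ᵗ , p , refl)
term-derivable (t ⊕ u) = derive₂ formation-mono (term-derivable t) (term-derivable u)
  λ p q → clause₃ (⌜ t ⌝ᵗ , ⌜ u ⌝ᵗ , p , q , refl)
term-derivable (t ⊗ u) = derive₂ formation-mono (term-derivable t) (term-derivable u)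
  λ p q → clause₄ (⌜ t ⌝ᵗ , ⌜ u ⌝ᵗ , p , q , refl)

form-derivable : ∀ A → Derivable Val.formationRule (Val.form ⌜ A ⌝)
form-derivable (t ≐ u) = derive₂ formation-mono (term-derivable t) (term-derivable u)
  λ p q → clause₅ (⌜ t ⌝ᵗ , ⌜ u ⌝ᵗ , p , q , refl)
form-derivable ⊥̇       = derive₀ (clause₆ refl)
form-derivable (A ⇒ B) = derive₂ formation-mono (form-derivable A) (form-derivable B)
  λ p q → clause₇ (⌜ A ⌝ , ⌜ B ⌝ , p , q , refl)
form-derivable (all A) = derive₁ (form-derivable A) λ p → clause₈ (⌜ A ⌝ , p , refl)

isTerm-complete : ∀ t → Val.IsTerm ⌜ t ⌝ᵗ
isTerm-complete t = let (_ , d , y∈) = term-derivable t in Derived⇒Generated formation-mono _ d y∈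

isFormula-complete : ∀ A → Val.IsFormula ⌜ A ⌝
isFormula-complete A = let (_ , d , y∈) = form-derivable A in Derived⇒Generated formation-mono _ d y∈

WellFormed : ℕ → Set
WellFormed y = (∃[ t ] y ≡ Val.term ⌜ t ⌝ᵗ) ⊎ (∃[ A ] y ≡ Val.form ⌜ A ⌝)

wellFormed-term : ∀ {t} → WellFormed (Val.term t) → ∃[ t′ ] t ≡ ⌜ t′ ⌝ᵗ
wellFormed-term (inj₁ (t , e)) = t , body-≡ e
wellFormed-term (inj₂ (A , e)) with () ← tag-≡ e

wellFormed-form : ∀ {a} → WellFormed (Val.form a) → ∃[ A ] a ≡ ⌜ A ⌝
wellFormed-form (inj₁ (t , e)) with () ← tag-≡ e
wellFormed-form (inj₂ (A , e)) = A , body-≡ e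

formation-closed : ∀ {E y} → (∀ {w} → E w → WellFormed w) → Val.formationRule E y → WellFormed y
formation-closed ih (clause₀ (i , e)) = inj₁ (var i , e)
formation-closed ih (clause₁ e) = inj₁ (𝟎 , e)
formation-closed ih (clause₂ (t , p , e)) with wellFormed-term (ih p)
... | t′ , refl = inj₁ (S t′ , e)
formation-closed ih (clause₃ (t , u , p , q , e)) with wellFormed-term (ih p) | wellFormed-term (ih q)
... | t′ , refl | u′ , refl = inj₁ (t′ ⊕ u′ , e)
formation-closed ih (clause₄ (t , u , p , q , e)) with wellFormed-term (ih p) | wellFormed-term (ih q)
... | t′ , refl | u′ , refl = inj₁ (t′ ⊗ u′ , e)
formation-closed ih (clause₅ (t , u , p , q , e)) with wellFormed-term (ih p) | wellFormed-term (ih q)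
... | t′ , refl | u′ , refl = inj₂ (t′ ≐ u′ , e)
formation-closed ih (clause₆ e) = inj₂ (⊥̇ , e)
formation-closed ih (clause₇ (a , b , p , q , e)) with wellFormed-form (ih p) | wellFormed-form (ih q)
... | A , refl | B , refl = inj₂ (A ⇒ B , e)
formation-closed ih (clause₈ (a , p , e)) with wellFormed-form (ih p)
... | A , refl = inj₂ (all A , e)

isTerm-sound : ∀ {t} → Val.IsTerm t → ∃[ t′ ] t ≡ ⌜ t′ ⌝ᵗ
isTerm-sound g = wellFormed-term (generated-elim {R = Val.formationRule} formation-closed g)

isFormula-sound : ∀ {a} → Val.IsFormula a → ∃[ A ] a ≡ ⌜ A ⌝
isFormula-sound g = wellFormed-form (generated-elim {R = Val.formationRule} formation-closed g)

subst-mono : Monotone Val.substRule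
subst-mono h (clause₀ c) = clause₀ c
subst-mono h (clause₁ c) = clause₁ c
subst-mono h (clause₂ c) = clause₂ c
subst-mono h (clause₃ c) = clause₃ c
subst-mono h (clause₄ c) = clause₄ c
subst-mono h (clause₅ c) = clause₅ c
subst-mono h (clause₆ (σ , i , t , u , p , q , e)) = clause₆ (σ , i , t , u , h p , h q , e)
subst-mono h (clause₇ c) = clause₇ c
subst-mono h (clause₈ (σ , t , u , p , e)) = clause₈ (σ , t , u , h p , e)
subst-mono h (clause₉ (σ , a , b , a′ , b′ , p , q , e)) =
  clause₉ (σ , a , b , a′ , b′ , h p , h q , e)
subst-mono h (clause₁₀ (σ , a , b , a′ , b′ , p , q , e)) =
  clause₁₀ (σ , a , b , a′ , b′ , h p , h q , e)
subst-mono h (clause₁₁ (σ , a , b , a′ , b′ , p , q , e)) =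
  clause₁₁ (σ , a , b , a′ , b′ , h p , h q , e)
subst-mono h (clause₁₂ c) = clause₁₂ c
subst-mono h (clause₁₃ (σ , a , b , a′ , b′ , p , q , e)) =
  clause₁₃ (σ , a , b , a′ , b′ , h p , h q , e)
subst-mono h (clause₁₄ (σ , a , b , p , e)) = clause₁₄ (σ , a , b , h p , e)

-- The variable case is a hypothesis because for `lift` it calls for `shift` on whole terms, which
-- is this very lemma at `shift`.
substᵗ-derivable : ∀ σ → (∀ i → Derivable Val.substRule (Val.sub ⌜ σ ⌝ˢ (cvar i) ⌜ σ at i ⌝ᵗ)) →
                   ∀ t → Derivable Val.substRule (Val.sub ⌜ σ ⌝ˢ ⌜ t ⌝ᵗ ⌜ t [ σ ]ᵗ ⌝ᵗ)
substᵗ-derivable σ vars (var i) = vars i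
substᵗ-derivable σ vars 𝟎       = derive₀ (clause₇ (⌜ σ ⌝ˢ , refl))
substᵗ-derivable σ vars (S t)   = derive₁ (substᵗ-derivable σ vars t)
  λ p → clause₈ (⌜ σ ⌝ˢ , ⌜ t ⌝ᵗ , ⌜ t [ σ ]ᵗ ⌝ᵗ , p , refl)
substᵗ-derivable σ vars (t ⊕ u) = derive₂ subst-mono (substᵗ-derivable σ vars t) (substᵗ-derivable σ vars u)
  λ p q → clause₉ (⌜ σ ⌝ˢ , ⌜ t ⌝ᵗ , ⌜ u ⌝ᵗ , ⌜ t [ σ ]ᵗ ⌝ᵗ , ⌜ u [ σ ]ᵗ ⌝ᵗ , p , q , refl)
substᵗ-derivable σ vars (t ⊗ u) = derive₂ subst-mono (substᵗ-derivable σ vars t) (substᵗ-derivable σ vars u)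
  λ p q → clause₁₀ (⌜ σ ⌝ˢ , ⌜ t ⌝ᵗ , ⌜ u ⌝ᵗ , ⌜ t [ σ ]ᵗ ⌝ᵗ , ⌜ u [ σ ]ᵗ ⌝ᵗ , p , q , refl)

shift-derivable : ∀ t → Derivable Val.substRule (Val.sub cshift ⌜ t ⌝ᵗ ⌜ raise t ⌝ᵗ)
shift-derivable = substᵗ-derivable shift λ i → derive₀ (clause₀ (i , refl))

at-derivable : ∀ σ i → Derivable Val.substRule (Val.sub ⌜ σ ⌝ˢ (cvar i) ⌜ σ at i ⌝ᵗ)
at-derivable shift    i       = shift-derivable (var i)
at-derivable (inst t) zero    = derive₀ (clause₁ (⌜ t ⌝ᵗ , refl))
at-derivable (inst t) (suc i) = derive₀ (clause₂ (⌜ t ⌝ᵗ , i , refl))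
at-derivable step     zero    = derive₀ (clause₃ refl)
at-derivable step     (suc i) = derive₀ (clause₄ (i , refl))
at-derivable (lift σ) zero    = derive₀ (clause₅ (⌜ σ ⌝ˢ , refl))
at-derivable (lift σ) (suc i) = derive₂ subst-mono (at-derivable σ i) (shift-derivable (σ at i))
  λ p q → clause₆ (⌜ σ ⌝ˢ , i , ⌜ σ at i ⌝ᵗ , ⌜ raise (σ at i) ⌝ᵗ , p , q , refl)

subst-derivable : ∀ A σ → Derivable Val.substRule (Val.sub ⌜ σ ⌝ˢ ⌜ A ⌝ ⌜ A [ σ ] ⌝)
subst-derivable (t ≐ u) σ = derive₂ subst-mono
  (substᵗ-derivable σ (at-derivable σ) t) (substᵗ-derivable σ (at-derivable σ) u)
  λ p q → clause₁₁ (⌜ σ ⌝ˢ , ⌜ t ⌝ᵗ , ⌜ u ⌝ᵗ , ⌜ t [ σ ]ᵗ ⌝ᵗ , ⌜ u [ σ ]ᵗ ⌝ᵗ , p , q , refl)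
subst-derivable ⊥̇       σ = derive₀ (clause₁₂ (⌜ σ ⌝ˢ , refl))
subst-derivable (A ⇒ B) σ = derive₂ subst-mono (subst-derivable A σ) (subst-derivable B σ)
  λ p q → clause₁₃ (⌜ σ ⌝ˢ , ⌜ A ⌝ , ⌜ B ⌝ , ⌜ A [ σ ] ⌝ , ⌜ B [ σ ] ⌝ , p , q , refl)
subst-derivable (all A) σ = derive₁ (subst-derivable A (lift σ))
  λ p → clause₁₄ (⌜ σ ⌝ˢ , ⌜ A ⌝ , ⌜ A [ lift σ ] ⌝ , p , refl)

substitutesTo-complete : ∀ σ A → Val.SubstitutesTo ⌜ σ ⌝ˢ ⌜ A ⌝ ⌜ A [ σ ] ⌝
substitutesTo-complete σ A = let (_ , d , y∈) = subst-derivable A σ in Derived⇒Generated subst-mono _ d y∈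

module _ (E : ℕ → Set) where

  -- The last two arguments are the tag and the body of the code of the substitution; tags 0 to 3
  -- are `shift`, `inst`, `step` and `lift`.
  VariableCase : ℕ → ℕ → ℕ → ℕ → Set
  VariableCase i b 0 r = b ≡ cvar (suc i)
  VariableCase i b 1 t = (i ≡ 0 × b ≡ t) ⊎ (∃[ j ] i ≡ suc j × b ≡ cvar j)
  VariableCase i b 2 r = (i ≡ 0 × b ≡ cS (cvar 0)) ⊎ (∃[ j ] i ≡ suc j × b ≡ cvar (suc j))
  VariableCase i b 3 σ = (i ≡ 0 × b ≡ cvar 0) ⊎
    (∃[ j ] ∃[ t ] i ≡ suc j × E (Val.sub σ (cvar j) t) × E (Val.sub cshift t b))
  VariableCase i b _ r = ⊥

  BinaryCase : (ℕ → ℕ → ℕ) → ℕ → ℕ → ℕ → Set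
  BinaryCase op σ b r = ∃[ t ] ∃[ u ] ∃[ t′ ] ∃[ u′ ]
    r ≡ ⟪ t , u ⟫ × E (Val.sub σ t t′) × E (Val.sub σ u u′) × b ≡ op t′ u′

  -- Indexed by the tag and the body of the code that is substituted into.
  SubstCase : ℕ → ℕ → ℕ → ℕ → Set
  SubstCase σ b 0 i = ∃[ k ] ∃[ r ] σ ≡ ⟪ k , r ⟫ × VariableCase i b k r
  SubstCase σ b 1 r = b ≡ czero
  SubstCase σ b 2 t = ∃[ u ] E (Val.sub σ t u) × b ≡ cS u
  SubstCase σ b 3 r = BinaryCase cplus σ b r
  SubstCase σ b 4 r = BinaryCase ctimes σ b r
  SubstCase σ b 5 r = BinaryCase ceq σ b r
  SubstCase σ b 6 r = b ≡ cbot
  SubstCase σ b 7 r = BinaryCase cimp σ b r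
  SubstCase σ b 8 a = ∃[ a′ ] E (Val.sub (clift σ) a a′) × b ≡ call a′
  SubstCase σ b _ r = ⊥

  sub-injective : ∀ {σ a b σ′ a′ b′} → Val.sub σ a b ≡ Val.sub σ′ a′ b′ → σ ≡ σ′ × a ≡ a′ × b ≡ b′
  sub-injective e = tag-≡ e , tag-≡ (body-≡ e) , body-≡ (body-≡ e)

  -- Sorting the fifteen clauses by tag once spares refuting the clauses of other shapes anew for
  -- every shape of term and formula.
  subst-case : ∀ {σ a b} → Val.substRule E (Val.sub σ a b) → ∃[ k ] ∃[ r ] a ≡ ⟪ k , r ⟫ × SubstCase σ b k r
  subst-case (clause₀ (i , e)) with sub-injective e
  ... | refl , a≡ , b≡ = 0 , _ , a≡ , 0 , _ , refl , b≡
  subst-case (clause₁ (t , e)) with sub-injective e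
  ... | refl , a≡ , b≡ = 0 , _ , a≡ , 1 , _ , refl , inj₁ (refl , b≡)
  subst-case (clause₂ (t , i , e)) with sub-injective e
  ... | refl , a≡ , b≡ = 0 , _ , a≡ , 1 , _ , refl , inj₂ (i , refl , b≡)
  subst-case (clause₃ e) with sub-injective e
  ... | refl , a≡ , b≡ = 0 , _ , a≡ , 2 , _ , refl , inj₁ (refl , b≡)
  subst-case (clause₄ (i , e)) with sub-injective e
  ... | refl , a≡ , b≡ = 0 , _ , a≡ , 2 , _ , refl , inj₂ (i , refl , b≡)
  subst-case (clause₅ (σ , e)) with sub-injective e
  ... | refl , a≡ , b≡ = 0 , _ , a≡ , 3 , _ , refl , inj₁ (refl , b≡)
  subst-case (clause₆ (σ , i , t , u , p , q , e)) with sub-injective e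
  ... | refl , a≡ , refl = 0 , _ , a≡ , 3 , _ , refl , inj₂ (i , t , refl , p , q)
  subst-case (clause₇ (σ , e)) with sub-injective e
  ... | refl , a≡ , b≡ = 1 , _ , a≡ , b≡
  subst-case (clause₈ (σ , t , u , p , e)) with sub-injective e
  ... | refl , a≡ , b≡ = 2 , _ , a≡ , u , p , b≡
  subst-case (clause₉ (σ , t , u , t′ , u′ , p , q , e)) with sub-injective e
  ... | refl , a≡ , b≡ = 3 , _ , a≡ , t , u , t′ , u′ , refl , p , q , b≡
  subst-case (clause₁₀ (σ , t , u , t′ , u′ , p , q , e)) with sub-injective e
  ... | refl , a≡ , b≡ = 4 , _ , a≡ , t , u , t′ , u′ , refl , p , q , b≡
  subst-case (clause₁₁ (σ , t , u , t′ , u′ , p , q , e)) with sub-injective e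
  ... | refl , a≡ , b≡ = 5 , _ , a≡ , t , u , t′ , u′ , refl , p , q , b≡
  subst-case (clause₁₂ (σ , e)) with sub-injective e
  ... | refl , a≡ , b≡ = 6 , _ , a≡ , b≡
  subst-case (clause₁₃ (σ , t , u , t′ , u′ , p , q , e)) with sub-injective e
  ... | refl , a≡ , b≡ = 7 , _ , a≡ , t , u , t′ , u′ , refl , p , q , b≡
  subst-case (clause₁₄ (σ , a , b , p , e)) with sub-injective e
  ... | refl , a≡ , b≡ = 8 , _ , a≡ , b , p , b≡

  subst-inversion : ∀ {σ k r b} → Val.substRule E (Val.sub σ ⟪ k , r ⟫ b) → SubstCase σ b k r
  subst-inversion {σ} {b = b} h with subst-case h
  ... | k , r , e , c = subst₂ (SubstCase σ b) (sym (tag-≡ e)) (sym (body-≡ e)) c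

  variable-inversion : ∀ {k r i b} → SubstCase ⟪ k , r ⟫ b 0 i → VariableCase i b k r
  variable-inversion {i = i} {b} (k , r , e , c) = subst₂ (VariableCase i b) (sym (tag-≡ e)) (sym (body-≡ e)) c

-- An entry of a derivation may relate numbers that code nothing, so correctness constrains only
-- entries whose first two components are codes. Nothing marks an entry as being about a term or
-- about a formula, so the induction carries both versions.
SubstCorrectᵗ SubstCorrect : ℕ → Set
SubstCorrectᵗ y = ∀ σ t {b} → y ≡ Val.sub ⌜ σ ⌝ˢ ⌜ t ⌝ᵗ b → b ≡ ⌜ t [ σ ]ᵗ ⌝ᵗ
SubstCorrect y  = ∀ σ A {b} → y ≡ Val.sub ⌜ σ ⌝ˢ ⌜ A ⌝ b → b ≡ ⌜ A [ σ ] ⌝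

module _ {E : ℕ → Set} where

  substᵗ-closed : ∀ {y} → (∀ {w} → E w → SubstCorrectᵗ w) → Val.substRule E y → SubstCorrectᵗ y
  substᵗ-closed ih r shift (var i) refl = variable-inversion E (subst-inversion E r)
  substᵗ-closed ih r (inst t) (var i) refl with variable-inversion E (subst-inversion E r)
  ... | inj₁ (refl , b≡)     = b≡
  ... | inj₂ (j , refl , b≡) = b≡
  substᵗ-closed ih r step (var i) refl with variable-inversion E (subst-inversion E r)
  ... | inj₁ (refl , b≡)     = b≡
  ... | inj₂ (j , refl , b≡) = b≡
  substᵗ-closed ih r (lift σ) (var i) refl with variable-inversion E (subst-inversion E r)
  ... | inj₁ (refl , b≡) = b≡
  ... | inj₂ (j , t , refl , p , q) with ih p σ (var j) refl
  ...   | refl = ih q shift (σ at j) refl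
  substᵗ-closed ih r σ 𝟎 refl = subst-inversion E r
  substᵗ-closed ih r σ (S t) refl with subst-inversion E r
  ... | u , p , refl = cong cS (ih p σ t refl)
  substᵗ-closed ih r σ (t ⊕ u) refl with subst-inversion E r
  ... | _ , _ , _ , _ , e , p , q , refl = cong₂ cplus
    (ih p σ t (cong (λ a → Val.sub ⌜ σ ⌝ˢ a _) (sym (tag-≡ e)))) (ih q σ u (cong (λ a → Val.sub ⌜ σ ⌝ˢ a _) (sym (body-≡ e))))
  substᵗ-closed ih r σ (t ⊗ u) refl with subst-inversion E r
  ... | _ , _ , _ , _ , e , p , q , refl = cong₂ ctimes
    (ih p σ t (cong (λ a → Val.sub ⌜ σ ⌝ˢ a _) (sym (tag-≡ e)))) (ih q σ u (cong (λ a → Val.sub ⌜ σ ⌝ˢ a _) (sym (body-≡ e))))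

  subst-closed : ∀ {y} → (∀ {w} → E w → SubstCorrectᵗ w × SubstCorrect w) → Val.substRule E y → SubstCorrect y
  subst-closed ih r σ (t ≐ u) refl with subst-inversion E r
  ... | _ , _ , _ , _ , e , p , q , refl = cong₂ ceq
    (proj₁ (ih p) σ t (cong (λ a → Val.sub ⌜ σ ⌝ˢ a _) (sym (tag-≡ e))))
    (proj₁ (ih q) σ u (cong (λ a → Val.sub ⌜ σ ⌝ˢ a _) (sym (body-≡ e))))
  subst-closed ih r σ ⊥̇ refl = subst-inversion E r
  subst-closed ih r σ (A ⇒ B) refl with subst-inversion E r
  ... | _ , _ , _ , _ , e , p , q , refl = cong₂ cimp
    (proj₂ (ih p) σ A (cong (λ a → Val.sub ⌜ σ ⌝ˢ a _) (sym (tag-≡ e))))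
    (proj₂ (ih q) σ B (cong (λ a → Val.sub ⌜ σ ⌝ˢ a _) (sym (body-≡ e))))
  subst-closed ih r σ (all A) refl with subst-inversion E r
  ... | a , p , refl = cong call (proj₂ (ih p) (lift σ) A refl)

substitutesTo-sound : ∀ σ A {b} → Val.SubstitutesTo ⌜ σ ⌝ˢ ⌜ A ⌝ b → b ≡ ⌜ A [ σ ] ⌝
substitutesTo-sound σ A g = proj₂
  (generated-elim {R = Val.substRule} {λ y → SubstCorrectᵗ y × SubstCorrect y}
    (λ ih r → substᵗ-closed (proj₁ ∘ ih) r , subst-closed ih r) g)
  σ A refl

proof-mono : Monotone Val.proofRule
proof-mono h (clause₀ c) = clause₀ c
proof-mono h (clause₁ c) = clause₁ c
proof-mono h (clause₂ c) = clause₂ c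
proof-mono h (clause₃ c) = clause₃ c
proof-mono h (clause₄ c) = clause₄ c
proof-mono h (clause₅ c) = clause₅ c
proof-mono h (clause₆ c) = clause₆ c
proof-mono h (clause₇ c) = clause₇ c
proof-mono h (clause₈ (a , p , q)) = clause₈ (a , h p , h q)
proof-mono h (clause₉ (a , p , e)) = clause₉ (a , h p , e)

⋁-code-∈ : ∀ {y} As → Val.⋁ (map (λ A → y ≡ ⌜ A ⌝) As) → ∃[ A ] A ∈ As × y ≡ ⌜ A ⌝
⋁-code-∈ (A ∷ As) (inj₁ e) = A , here refl , e
⋁-code-∈ (_ ∷ As) (inj₂ d) = let (A , p , e) = ⋁-code-∈ As d in A , there p , e

∈-⋁-code : ∀ {A As} → A ∈ As → Val.⋁ (map (λ B → ⌜ A ⌝ ≡ ⌜ B ⌝) As)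
∈-⋁-code (here refl) = inj₁ refl
∈-⋁-code (there p)   = inj₂ (∈-⋁-code p)

proof-derivable : ∀ {A} → PA⊢ A → Derivable Val.proofRule ⌜ A ⌝
proof-derivable (basic p) = derive₀ (clause₀ (∈-⋁-code p))
proof-derivable (ax-K {A} {B}) = derive₀ (clause₁ (_ , _ , isFormula-complete A , isFormula-complete B , refl))
proof-derivable (ax-S {A} {B} {C}) =
  derive₀ (clause₂ (_ , _ , _ , isFormula-complete A , isFormula-complete B , isFormula-complete C , refl))
proof-derivable (ax-DN {A}) = derive₀ (clause₃ (_ , isFormula-complete A , refl))
proof-derivable (ax-inst {A} t) = derive₀ (clause₄ (_ , _ , _ , isFormula-complete A , isTerm-complete t ,
  substitutesTo-complete (inst t) A , refl))
proof-derivable (ax-dist {A} {B}) = derive₀ (clause₅ (_ , _ , isFormula-complete A , isFormula-complete B , refl))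
proof-derivable (ax-vac {A}) =
  derive₀ (clause₆ (_ , _ , isFormula-complete A , substitutesTo-complete shift A , refl))
proof-derivable (induction {A}) = derive₀ (clause₇ (_ , _ , _ , isFormula-complete A ,
  substitutesTo-complete (inst 𝟎) A , substitutesTo-complete step A , refl))
proof-derivable (mp {A} p q) = derive₂ proof-mono (proof-derivable p) (proof-derivable q)
  λ p q → clause₈ (⌜ A ⌝ , p , q)
proof-derivable (gen {A} p) = derive₁ (proof-derivable p) λ p → clause₉ (⌜ A ⌝ , p , refl)

proof-complete : ∀ {A} → PA⊢ A → ∃[ x ] Val.Proof x ⌜ A ⌝
proof-complete p =
  let (_ , d , y∈) = proof-derivable p
      (s , n , derivation) = Derived⇒Generated proof-mono _ d y∈
  in ⟪ s , n ⟫ , s , n , refl , derivation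

IsTheorem : ℕ → Set
IsTheorem y = ∃[ A ] y ≡ ⌜ A ⌝ × PA⊢ A

proof-closed : ∀ {E y} → (∀ {w} → E w → IsTheorem w) → Val.proofRule E y → IsTheorem y
proof-closed ih (clause₀ c) = let (A , p , e) = ⋁-code-∈ basicAxioms c in A , e , basic p
proof-closed ih (clause₁ (a , b , p , q , e)) with isFormula-sound p | isFormula-sound q
... | A , refl | B , refl = _ ⇒ _ ⇒ _ , e , ax-K {A} {B}
proof-closed ih (clause₂ (a , b , c , p , q , r , e))
  with isFormula-sound p | isFormula-sound q | isFormula-sound r
... | A , refl | B , refl | C , refl = _ , e , ax-S {A} {B} {C}
proof-closed ih (clause₃ (a , p , e)) with isFormula-sound p
... | A , refl = _ , e , ax-DN {A}
proof-closed ih (clause₄ (a , t , b , p , q , r , e)) with isFormula-sound p | isTerm-sound q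
... | A , refl | t′ , refl with substitutesTo-sound (inst t′) A r
... | refl = _ , e , ax-inst {A} t′
proof-closed ih (clause₅ (a , b , p , q , e)) with isFormula-sound p | isFormula-sound q
... | A , refl | B , refl = _ , e , ax-dist {A} {B}
proof-closed ih (clause₆ (a , b , p , r , e)) with isFormula-sound p
... | A , refl with substitutesTo-sound shift A r
... | refl = _ , e , ax-vac {A}
proof-closed ih (clause₇ (a , b , c , p , r , r′ , e)) with isFormula-sound p
... | A , refl with substitutesTo-sound (inst 𝟎) A r | substitutesTo-sound step A r′
... | refl | refl = _ , e , induction {A}
proof-closed ih (clause₈ (a , p , q)) with ih p | ih q
... | A , refl , ⊢A | C , e , ⊢C with cimp-inversion A C e
... | B , refl , y≡ = B , y≡ , mp ⊢A ⊢C
proof-closed ih (clause₉ (a , p , e)) with ih p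
... | A , refl , ⊢A = all A , e , gen ⊢A

provable-sound : ∀ A → Val.Provable ⌜ A ⌝ → PA⊢ A
provable-sound A (x , s , n , _ , derivation)
  with generated-elim {R = Val.proofRule} proof-closed (s , n , derivation)
... | B , e , ⊢B with code-injective A B e
... | refl = ⊢B

-- Constructive falsity excludes provability

□-Σ₁ : ∀ G → □ G ≡ ⌊ Syn.Box (lv 0) (lnum ⌜ G ⌝) 1 ⌋ 1
□-Σ₁ G = refl

x:-Σ₁ : ∀ F → x: F ≡ ⌊ Syn.Proof (lv 0) (lnum ⌜ F ⌝) 1 ⌋ 1
x:-Σ₁ F = refl

box-scoped : ∀ g → Scoped 1 (Syn.Box (lv 0) (lnum g) 1)
box-scoped g = toWitness {a? = scoped? 1 (Syn.Box (lv 0) (lnum g) 1)} _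

proof-scoped : ∀ g → Scoped 1 (Syn.Proof (lv 0) (lnum g) 1)
proof-scoped g = toWitness {a? = scoped? 1 (Syn.Proof (lv 0) (lnum g) 1)} _

□-sound : ∀ G {x ρ} → ⟦ □ G ⟧ (x ∷ᵉ ρ) → ¬ ¬ PA⊢ G [ inst (numeral x) ]
□-sound G {x} {ρ} h k = ⟦⟧⇒Holds (Syn.Box (lv 0) (lnum ⌜ G ⌝) 1) {1} {x ∷ᵉ ρ} (box-scoped ⌜ G ⌝)
    (subst (λ A → ⟦ A ⟧ (x ∷ᵉ ρ)) (□-Σ₁ G) h) λ box → k (unbox box)
  where
  unbox : Val.Box x ⌜ G ⌝ → PA⊢ G [ inst (numeral x) ]
  unbox (u , z , nu , su , pr) = provable-sound (G [ inst (numeral x) ])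
    (subst Val.Provable (substitutesTo-sound (inst (numeral x)) G
      (subst (λ u → Val.SubstitutesTo (Val.cinst u) ⌜ G ⌝ z) (numeralCode-sound nu) su)) pr)

-- Boxes come off one at a time: truth of `□ H` at x gives a proof of H at the numeral of x, and
-- soundness turns it back into truth of H at x. Stability of `G` removes the double negation.
□^-reflects : ∀ n G {x ρ} → ⟦ □^ n G ⟧ (x ∷ᵉ ρ) → ⟦ G ⟧ (x ∷ᵉ ρ)
□^-reflects zero    G h = h
□^-reflects (suc n) G {x} {ρ} h = ⟦⟧-stable G λ k → □-sound (□^ n G) h λ p →
  k (□^-reflects n G (⟦⟧-cong (□^ n G) (λ { zero → eval-numeral ρ x ; (suc i) → refl })
    (⟦inst⟧⇒ (□^ n G) (numeral x) (soundness p ρ))))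

cf-unprovable : ∀ n F → PA⊢ cf n F → ¬ PA⊢ F
cf-unprovable n F p q = let (x , pr) = proof-complete q in □^-reflects n (~ (x: F)) (soundness p (λ _ → 0) x)
  (subst (λ A → ⟦ A ⟧ (x ∷ᵉ λ _ → 0)) (sym (x:-Σ₁ F))
    (Holds⇒⟦⟧ (Syn.Proof (lv 0) (lnum ⌜ F ⌝) 1) {1} {x ∷ᵉ λ _ → 0} (proof-scoped ⌜ F ⌝) pr))

-- x: F and □ G, with the codes of F and G replaced by a parameter

proofTemplate boxTemplate : Formula
proofTemplate = ⌊ Syn.Proof (lv 1) (lv 0) 2 ⌋ 2
boxTemplate   = ⌊ Syn.Box (lv 1) (lv 0) 2 ⌋ 2

template-[] : ∀ {g F F′ A} → Scoped 2 F → setParam g F ≡ F′ → A ≡ ⌊ F′ ⌋ 1 →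
              ⌊ F ⌋ 2 [ lift (inst (numeral g)) ] ≡ A
template-[] {g} {F} scoped refl refl = setParam-[] g F 1 (s≤s z≤n) scoped

proof-setParam : ∀ g → setParam g (Syn.Proof (lv 1) (lv 0) 2) ≡ Syn.Proof (lv 0) (lnum g) 1
proof-setParam g = refl

box-setParam : ∀ g → setParam g (Syn.Box (lv 1) (lv 0) 2) ≡ Syn.Box (lv 0) (lnum g) 1
box-setParam g = refl

proofTemplate-scoped : Scoped 2 (Syn.Proof (lv 1) (lv 0) 2)
proofTemplate-scoped = toWitness {a? = scoped? 2 (Syn.Proof (lv 1) (lv 0) 2)} _

boxTemplate-scoped : Scoped 2 (Syn.Box (lv 1) (lv 0) 2)
boxTemplate-scoped = toWitness {a? = scoped? 2 (Syn.Box (lv 1) (lv 0) 2)} _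

proofTemplate-[] : ∀ F → proofTemplate [ lift (inst (numeral ⌜ F ⌝)) ] ≡ x: F
proofTemplate-[] F = template-[] {⌜ F ⌝} {Syn.Proof (lv 1) (lv 0) 2} {Syn.Proof (lv 0) (lnum ⌜ F ⌝) 1} {x: F}
  proofTemplate-scoped (proof-setParam ⌜ F ⌝) (x:-Σ₁ F)

boxTemplate-[] : ∀ G → boxTemplate [ lift (inst (numeral ⌜ G ⌝)) ] ≡ □ G
boxTemplate-[] G = template-[] {⌜ G ⌝} {Syn.Box (lv 1) (lv 0) 2} {Syn.Box (lv 0) (lnum ⌜ G ⌝) 1} {□ G}
  boxTemplate-scoped (box-setParam ⌜ G ⌝) (□-Σ₁ G)

template-sound : ∀ {A} T g {u t} → T [ lift (inst (numeral g)) ] ≡ A → Val.NumeralCode g u →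
                 Val.SubstitutesTo (Val.clift (Val.cinst u)) ⌜ T ⌝ t → t ≡ ⌜ A ⌝
template-sound T g {t = t} refl nu su = substitutesTo-sound (lift (inst (numeral g))) T
  (subst (λ u → Val.SubstitutesTo (Val.clift (Val.cinst u)) ⌜ T ⌝ t) (numeralCode-sound nu) su)

template-complete : ∀ {A} T g → T [ lift (inst (numeral g)) ] ≡ A →
                    Val.SubstitutesTo (Val.clift (Val.cinst ⌜ numeral g ⌝ᵗ)) ⌜ T ⌝ ⌜ A ⌝
template-complete T g refl = substitutesTo-complete (lift (inst (numeral g))) T

-- x: F, □ and the templates are abstract here to keep Agda from unfolding them.

module FalsityCodes {X : Formula} {box : Formula → Formula} {P B : Formula} (f : ℕ)
  (P-[] : P [ lift (inst (numeral f)) ] ≡ X)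
  (B-[] : ∀ G → B [ lift (inst (numeral ⌜ G ⌝)) ] ≡ box G)
  (iterate : ℕ → Formula) (iterate-zero : iterate 0 ≡ ~ X)
  (iterate-suc : ∀ n → iterate (suc n) ≡ box (iterate n)) where

  private
    R : Val.Rule
    R = Val.cfRule ⌜ P ⌝ ⌜ B ⌝ f

    Q : ℕ → Set
    Q y = ∃[ n ] y ≡ ⌜ iterate n ⌝

    closed : ∀ {E y} → (∀ {w} → E w → Q w) → R E y → Q y
    closed ih (clause₀ (u , t , nu , su , e)) = 0 , trans e (trans
      (cong (λ c → Val.cimp c Val.cbot) (template-sound P f P-[] nu su)) (sym (cong ⌜_⌝ iterate-zero)))
    closed ih (clause₁ (g , u , p , nu , su)) = let (n , g≡) = ih p in suc n , trans
      (template-sound B g (trans (cong (λ g → B [ lift (inst (numeral g)) ]) g≡) (B-[] (iterate n))) nu su)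
      (sym (cong ⌜_⌝ (iterate-suc n)))

    mono : Monotone R
    mono h (clause₀ c) = clause₀ c
    mono h (clause₁ (g , u , p , q)) = clause₁ (g , u , h p , q)

    derivable : ∀ n → Derivable R ⌜ iterate n ⌝
    derivable zero = subst (λ A → Derivable R ⌜ A ⌝) (sym iterate-zero) (derive₀
      (clause₀ (⌜ numeral f ⌝ᵗ , ⌜ X ⌝ , numeralCode-complete f , template-complete P f P-[] , refl)))
    derivable (suc n) = subst (λ A → Derivable R ⌜ A ⌝) (sym (iterate-suc n)) (derive₁ (derivable n) λ p →
      clause₁ (⌜ iterate n ⌝ , ⌜ numeral ⌜ iterate n ⌝ ⌝ᵗ , p , numeralCode-complete ⌜ iterate n ⌝ ,
        template-complete B ⌜ iterate n ⌝ (B-[] (iterate n))))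

  iterate-sound : ∀ {y} → Val.Generated R y → Q y
  iterate-sound = generated-elim {R = R} {Q} closed

  iterate-complete : ∀ n → Val.Generated R ⌜ iterate n ⌝
  iterate-complete n = let (_ , d , y∈) = derivable n in Derived⇒Generated mono _ d y∈

module Codes (F : Formula) = FalsityCodes {x: F} {□_} {proofTemplate} {boxTemplate} ⌜ F ⌝
  (proofTemplate-[] F) boxTemplate-[] (λ n → □^ n (~ (x: F))) refl (λ n → refl)

-- Rosser sentences

substVars-agree : ∀ {n f g} t → (∀ i → i < n → f i ≡ g i) → VarsBelowᵗ n t → substVars f t ≡ substVars g t
substVars-agree (var i) h p       = h i p
substVars-agree 𝟎       h p       = refl
substVars-agree (S t)   h p       = cong S_ (substVars-agree t h p)
substVars-agree (t ⊕ u) h (p , q) = cong₂ _⊕_ (substVars-agree t h p) (substVars-agree u h q)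
substVars-agree (t ⊗ u) h (p , q) = cong₂ _⊗_ (substVars-agree t h p) (substVars-agree u h q)

∙-agree : ∀ {n f g} A → (∀ i → i < n → f i ≡ g i) → VarsBelow n A → A ∙ f ≡ A ∙ g
∙-agree (t ≐ u) h (p , q) = cong₂ _≐_ (substVars-agree t h p) (substVars-agree u h q)
∙-agree ⊥̇       h p       = refl
∙-agree (A ⇒ B) h (p , q) = cong₂ _⇒_ (∙-agree A h p) (∙-agree B h q)
∙-agree (all A) h p       = cong all
  (∙-agree A (λ { zero _ → refl ; (suc i) (s≤s i<n) → cong raise (h i i<n) }) p)

-- Makes room at index 1 for w, between the bounded variable v and the parameters.
skip : ℕ → Term
skip = var 0 ∷ᵉ λ i → var (suc (suc i))

-- "P holds at some w, and Q at no v ≤ w"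
before : Formula → Formula → Formula
before P Q = ~ all (~ ~ (P ⇒ ~ all≤ 0 (~ Q ∙ skip)))

module _ {P Q : Formula} (P-Δ₀ : Δ₀ P) (Q-Δ₀ : Δ₀ Q) (ρ : Env) where

  private
    ν : ℕ → Term
    ν = numeral ∘ ρ

    R : Formula
    R = all≤ 0 (~ Q ∙ skip)

    skip-⟨⟩ : ∀ v w → Q ∙ skip ⟨ v ∷ᵉ w ∷ᵉ ρ ⟩ ≡ Q ⟨ v ∷ᵉ ρ ⟩
    skip-⟨⟩ v w = trans (∙-∘ _ skip Q) (∙-cong (λ { zero → refl ; (suc i) → refl }) Q)

  before-provable : ∀ m → ⟦ P ⟧ (m ∷ᵉ ρ) → (∀ v → v ≤ m → ¬ ⟦ Q ⟧ (v ∷ᵉ ρ)) → PA⊢ before P Q ⟨ ρ ⟩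
  before-provable m p q = ∃-intro (numeral m)
    (subst PA⊢_ (sym (⟨⟩-inst (~ (P ⇒ ~ R)) ρ m))
      (ap (ap identity (const (decide-true P-Δ₀ p))) (const none)))
    where
    none : PA⊢ R ⟨ m ∷ᵉ ρ ⟩
    none = all≤-intro 0 (~ Q ∙ skip) (m ∷ᵉ ρ) λ v v≤m →
      subst (λ A → PA⊢ ~ A) (sym (skip-⟨⟩ v m)) (decide-false Q-Δ₀ (q v v≤m))

  -- Inside PA, w is either a numeral below n, where P is refutable, or an n-fold successor, where v
  -- = n satisfies both the bound and Q. `cases` at n makes this split.
  before-refutable : ∀ n → ⟦ Q ⟧ (n ∷ᵉ ρ) → (∀ k → k < n → ¬ ⟦ P ⟧ (k ∷ᵉ ρ)) → PA⊢ ~ (before P Q ⟨ ρ ⟩)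
  before-refutable n q p = ~~-intro (cases n (C ∙ exts ν) below above)
    where
    C : Formula
    C = ~ ~ (P ⇒ ~ R)
    below : ∀ k → k < n → PA⊢ C ∙ exts ν [ inst (numeral k) ]
    below k k<n = subst PA⊢_ (sym (⟨⟩-inst C ρ k))
      (~~-intro (⇒-trans (decide-false P-Δ₀ (p k k<n)) exfalso))
    Q″ : Formula
    Q″ = Q ∙ skip ∙ exts (exts ν) ∙ exts (step^ n)
    pointwise : ∀ i → substVars (exts (step^ n)) (substVars (exts (exts ν)) (skip i)) [ inst (numeral n) ]ᵗ ≡
                      numeral ((n ∷ᵉ ρ) i)
    pointwise zero    = refl
    pointwise (suc i) = trans (cong (λ t → substVars (exts (step^ n)) t [ inst (numeral n) ]ᵗ)
        (trans (cong raise (substVars-numeral _ (ρ i))) (substVars-numeral _ (ρ i))))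
      (trans (cong _[ inst (numeral n) ]ᵗ (substVars-numeral _ (ρ i))) (substVars-numeral _ (ρ i)))
    Q″-inst : Q″ [ inst (numeral n) ] ≡ Q ⟨ n ∷ᵉ ρ ⟩
    Q″-inst = trans (cong (λ A → A ∙ exts (step^ n) [ inst (numeral n) ]) (∙-∘ _ skip Q))
      (trans (cong (_[ inst (numeral n) ]) (∙-∘ _ _ Q))
      (trans (∙-[] _ _ Q) (∙-cong pointwise Q)))
    raise-lift-inst : raise (raise (S^ n (var 0))) [ lift (inst (numeral n)) ]ᵗ ≡ raise (S^ n (var 0))
    raise-lift-inst = trans (substVars-∘ _ _ (raise (S^ n (var 0))))
      (trans (substVars-∘ _ _ (S^ n (var 0))) refl)
    at-n : PA⊢ R ∙ exts ν ∙ step^ n ⇒ numeral n ≤ᵗ S^ n (var 0) ⇒ ~ Q ⟨ n ∷ᵉ ρ ⟩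
    at-n = subst₂ (λ t A → PA⊢ R ∙ exts ν ∙ step^ n ⇒ ~ all (~ (var 0 ⊕ raise (numeral n) ≐ t)) ⇒ ~ A)
      raise-lift-inst Q″-inst (ax-inst (numeral n))
    above : PA⊢ C ∙ exts ν ∙ step^ n
    above = ~~-intro (const (ap (ap at-n (const (numeral-≤-S^ n (var 0)))) (const (decide-true Q-Δ₀ q))))

-- Level 0 of `F` and `G` is the parameter. Level 1, which they avoid, carries the bound of `cut`
-- and is the variable that `before` compares.
module Rosser (F G : Σ₁) (F-scoped : Scoped 2 F) (G-scoped : Scoped 2 G)
              (F-avoids : Avoids 1 F) (G-avoids : Avoids 1 G) where

  rosser : Formula
  rosser = before (cut 1 F 2) (cut 1 G 2)

  -- The parameter of F and G is the code of rosser.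
  sentence : Formula
  sentence = rosser [ inst (numeral ⌜ rosser ⌝) ]

  environment : Env
  environment _ = ⌜ rosser ⌝

  rosser-VarsBelow : VarsBelow 1 rosser
  rosser-VarsBelow = (((VarsBelow-cut 1 F 2 (s≤s z≤n) , VarsBelow-all≤ (~ cut 1 G 2 ∙ skip) (s≤s z≤n)
    (VarsBelow-subst (cut 1 G 2) skip-below (VarsBelow-cut 1 G 2 (s≤s z≤n)) , tt) , tt) , tt) , tt) , tt
    where
    skip-below : ∀ i → i < 2 → VarsBelowᵗ 3 (skip i)
    skip-below 0       _         = s≤s z≤n
    skip-below (suc i) (s≤s i<1) = s≤s (s≤s i<1)

  sentence-≡ : sentence ≡ rosser ⟨ environment ⟩
  sentence-≡ = trans ([]-∙ _ rosser) (∙-agree {1} {inst (numeral ⌜ rosser ⌝) at_} {numeral ∘ environment} rosser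
    (λ { zero _ → refl ; (suc i) (s≤s ()) }) rosser-VarsBelow)

  sentence-closed : IsSentence sentence
  sentence-closed = subst (VarsBelow 0) (sym sentence-≡)
    (VarsBelow-subst {f = numeral ∘ environment} rosser (λ i _ → VarsBelowᵗ-numeral 0 ⌜ rosser ⌝) rosser-VarsBelow)

  diagonal-sound : ∀ {f} → Val.Diagonal ⌜ rosser ⌝ f → f ≡ ⌜ sentence ⌝
  diagonal-sound {f} (u , nu , su) = substitutesTo-sound (inst (numeral ⌜ rosser ⌝)) rosser
    (subst (λ u → Val.SubstitutesTo (Val.cinst u) ⌜ rosser ⌝ f) (numeralCode-sound nu) su)

  diagonal-complete : Val.Diagonal ⌜ rosser ⌝ ⌜ sentence ⌝
  diagonal-complete = ⌜ numeral ⌜ rosser ⌝ ⌝ᵗ , numeralCode-complete ⌜ rosser ⌝ ,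
    substitutesTo-complete (inst (numeral ⌜ rosser ⌝)) rosser

  module _ (F-refutes : ∀ m → Holds F 2 (m ∷ᵉ environment) → ¬ PA⊢ sentence)
           (G-refutes : ∀ m → Holds G 2 (m ∷ᵉ environment) → ¬ PA⊢ ~ sentence) where

    private
      -- Strong induction, with `G` treated first. If the cut of `G` holds at n while that of `F`
      -- holds nowhere below, PA refutes the sentence, against `G-refutes`. If the cut of `F` holds
      -- at n, that of `G` holds at no v ≤ n, the case v = n being the first half; so PA proves the
      -- sentence, against `F-refutes`.
      cuts-false : ∀ n → ¬ ⟦ cut 1 F 2 ⟧ (n ∷ᵉ environment) × ¬ ⟦ cut 1 G 2 ⟧ (n ∷ᵉ environment)
      cuts-false = <-rec _ λ n ih →
        let ¬g = λ g → cut-sound 1 G G-scoped g λ h → G-refutes n h (subst (λ A → PA⊢ ~ A) (sym sentence-≡)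
              (before-refutable (cut-Δ₀ 1 F 2) (cut-Δ₀ 1 G 2) environment n g λ k k<n → proj₁ (ih k<n)))
        in (λ f → cut-sound 1 F F-scoped f λ h → F-refutes n h (subst PA⊢_ (sym sentence-≡)
              (before-provable (cut-Δ₀ 1 F 2) (cut-Δ₀ 1 G 2) environment n f λ v v≤n →
                [ (λ v<n → proj₂ (ih v<n)) , (λ { refl → ¬g }) ]′ (m≤n⇒m<n∨m≡n v≤n)))) , ¬g

      -- The 0 is a placeholder at level 1, which `H` avoids; a large enough bound m replaces it.
      cut-holds : ∀ H → Scoped 2 H → Avoids 1 H → Holds H 2 (0 ∷ᵉ environment) →
                  ∃[ m ] ⟦ cut 1 H 2 ⟧ (m ∷ᵉ environment)
      cut-holds H scoped avoids h with cut-complete 1 H ≤-refl scoped avoids h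
      ... | m , f = m , f (m ∷ᵉ environment)
        (λ { 0 _ _ → refl ; 1 _ l≢1 → ⊥-elim (l≢1 refl) ; (suc (suc _)) (s≤s (s≤s ())) _ }) ≤-refl

    F-fails : ¬ Holds F 2 (0 ∷ᵉ environment)
    F-fails h = let (m , c) = cut-holds F F-scoped F-avoids h in proj₁ (cuts-false m) c

    G-fails : ¬ Holds G 2 (0 ∷ᵉ environment)
    G-fails h = let (m , c) = cut-holds G G-scoped G-avoids h in proj₂ (cuts-false m) c

-- Mutual irrefutability and extreme independence

-- All that the argument uses of `cf`: `cfRule` generates exactly the codes of the iterates, and
-- provable falsity excludes provability.
module Independence (p b : ℕ) (falsity : Formula → ℕ → Formula)
  (falsity-sound : ∀ F {y} → Val.Generated (Val.cfRule p b ⌜ F ⌝) y → ∃[ n ] y ≡ ⌜ falsity F n ⌝)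
  (falsity-complete : ∀ F n → Val.Generated (Val.cfRule p b ⌜ F ⌝) ⌜ falsity F n ⌝)
  (falsity-unprovable : ∀ F n → PA⊢ all (falsity F n) → ¬ PA⊢ F) where

  -- `F′` is meant to contradict `F`. The index n = 0 is included because the generation of the
  -- codes starts there; `cf-unprovable` covers it as well.
  Refutation : Formula → Formula → Set
  Refutation F F′ = PA⊢ F′ ⊎ (∃[ n ] PA⊢ all (falsity F n))

  refuted-sound : ∀ F F′ → Val.Refuted p b ⌜ F ⌝ ⌜ F′ ⌝ → Refutation F F′
  refuted-sound F F′ (y , inj₁ y≡ , pr) = inj₁ (provable-sound F′ (subst Val.Provable y≡ pr))
  refuted-sound F F′ (y , inj₂ (c , g , y≡) , pr) = let (n , c≡) = falsity-sound F g in
    inj₂ (n , provable-sound (all (falsity F n)) (subst Val.Provable (trans y≡ (cong Val.call c≡)) pr))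

  refuted-complete : ∀ F F′ → Refutation F F′ → Val.Refuted p b ⌜ F ⌝ ⌜ F′ ⌝
  refuted-complete F F′ (inj₁ p)       = ⌜ F′ ⌝ , inj₁ refl , proof-complete p
  refuted-complete F F′ (inj₂ (n , p)) =
    ⌜ all (falsity F n) ⌝ , inj₂ (⌜ falsity F n ⌝ , falsity-complete F n , refl) , proof-complete p

  refutation-excludes : ∀ {F F′} → (PA⊢ F → PA⊢ F′ → ⊥) → Refutation F F′ → ¬ PA⊢ F
  refutation-excludes incompatible (inj₁ q)       p = incompatible p q
  refutation-excludes incompatible (inj₂ (n , q)) p = falsity-unprovable _ n q p

  consistent : ∀ {A} → PA⊢ A → PA⊢ ~ A → ⊥
  consistent p q = soundness q (λ _ → 0) (soundness p (λ _ → 0))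

  refutedDiagonal refutedNegation : Σ₁
  refutedDiagonal = Syn.RefutedDiagonal p b (lv 0) 2
  refutedNegation = Syn.RefutedNegation p b (lv 0) 2

  open Rosser refutedDiagonal refutedNegation
    (toWitness {a? = scoped? 2 refutedDiagonal} _) (toWitness {a? = scoped? 2 refutedNegation} _)
    (toWitness {a? = avoids? 1 refutedDiagonal} _) (toWitness {a? = avoids? 1 refutedNegation} _)

  -- `Holds` of data built by `Syn` computes to the corresponding statement of `Val`, so the
  -- conversions are identities; naming them fixes which form of the type is meant.
  holds⇒diagonal : ∀ m ρ → Holds refutedDiagonal 2 (m ∷ᵉ ρ) → Val.RefutedDiagonal p b (ρ 0)
  holds⇒diagonal m ρ h = h

  diagonal⇒holds : ∀ m ρ → Val.RefutedDiagonal p b (ρ 0) → Holds refutedDiagonal 2 (m ∷ᵉ ρ)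
  diagonal⇒holds m ρ h = h

  holds⇒negation : ∀ m ρ → Holds refutedNegation 2 (m ∷ᵉ ρ) → Val.RefutedNegation p b (ρ 0)
  holds⇒negation m ρ h = h

  negation⇒holds : ∀ m ρ → Val.RefutedNegation p b (ρ 0) → Holds refutedNegation 2 (m ∷ᵉ ρ)
  negation⇒holds m ρ h = h

  diagonal-refutes : ∀ m → Holds refutedDiagonal 2 (m ∷ᵉ environment) → ¬ PA⊢ sentence
  diagonal-refutes m h = let (f , dg , r) = holds⇒diagonal m environment h in
    refutation-excludes consistent (refuted-sound sentence (~ sentence)
      (subst (λ f → Val.Refuted p b f (Val.cimp f Val.cbot)) (diagonal-sound dg) r))

  negation-refutes : ∀ m → Holds refutedNegation 2 (m ∷ᵉ environment) → ¬ PA⊢ ~ sentence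
  negation-refutes m h = let (f , dg , r) = holds⇒negation m environment h in
    refutation-excludes (λ p q → consistent q p) (refuted-sound (~ sentence) sentence
      (subst (λ f → Val.Refuted p b (Val.cimp f Val.cbot) f) (diagonal-sound dg) r))

  ¬refutation : ¬ Refutation sentence (~ sentence)
  ¬refutation r = F-fails diagonal-refutes negation-refutes (diagonal⇒holds 0 environment
    (⌜ sentence ⌝ , diagonal-complete , refuted-complete sentence (~ sentence) r))

  ¬refutation-~ : ¬ Refutation (~ sentence) sentence
  ¬refutation-~ r = G-fails diagonal-refutes negation-refutes (negation⇒holds 0 environment
    (⌜ sentence ⌝ , diagonal-complete , refuted-complete (~ sentence) sentence r))

  unrefuted-sentence : ∃[ A ] (IsSentence A × ¬ Refutation A (~ A) × ¬ Refutation (~ A) A)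
  unrefuted-sentence = sentence , sentence-closed , ¬refutation , ¬refutation-~

open Independence ⌜ proofTemplate ⌝ ⌜ boxTemplate ⌝ (λ F n → □^ n (~ (x: F)))
  Codes.iterate-sound Codes.iterate-complete (λ F n → cf-unprovable n F)
  using (Refutation; unrefuted-sentence)

-- The conditions cross: a proof of A counts as a refutation of `~ A`, and a proof of `~ A` as one
-- of A. Hence each strong independence draws on both hypotheses.
unrefuted⇒independent : ∀ {A} → ¬ Refutation A (~ A) → ¬ Refutation (~ A) A → ExtremelyIndependent A
unrefuted⇒independent r r′ =
  ((λ p → r′ (inj₁ p)) , (λ (n , _ , p) → r (inj₂ (n , p)))) ,
  ((λ p → r (inj₁ p)) , (λ (n , _ , p) → r′ (inj₂ (n , p))))

theorem4p6 : ∃[ A ] (IsSentence A × ExtremelyIndependent A)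
theorem4p6 = map₂ (λ (closed , r , r′) → closed , unrefuted⇒independent r r′) unrefuted-sentence
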